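{- For any integers $k\ge 1$ and $l\ge 2$, as $n\to\infty$, $$ex(n,C_{2l},C_{2k+1})=(1+o(1))\frac{1}{2l}\left(\frac{n^2}{4}\right)^l.$$
   Context: $C_k$ denotes the cycle with $k$ vertices. $ex(n,H,F)$ is the maximum number of subgraphs isomorphic to $H$ in an $n$-vertex graph containing no subgraph isomorphic to $F$. -}

module Defs where

open import Data.Bool.Base using (Bool; true; false)
open import Data.Fin.Base using (Fin; toℕ)
open import Data.Fin.Properties using (any?; all?) renaming (_≟_ to _≟ᶠ_)
open import Data.Fin.Subset using (Subset; _∈_)
open import Data.Fin.Subset.Properties using (_∈?_)
open import Data.List.Base using (List; []; _∷_; [_]; map; filter; length; allFin; cartesianProductWith)
open import Data.List.Extrema.Nat using (max; xs≤max; argmax-sel)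
open import Data.List.Membership.Propositional using (lose) renaming (_∈_ to _∈ˡ_)
open import Data.List.Membership.Propositional.Properties using (∈-map⁺; ∈-map⁻; ∈-filter⁺; ∈-filter⁻; ∈-allFin; ∈-cartesianProductWith⁺)
open import Data.List.Properties using (filter-≐)
open import Data.List.Relation.Unary.All using (All; []; _∷_) renaming (lookup to lookupᴬ)
open import Data.List.Relation.Unary.AllPairs using ([]; _∷_)
open import Data.List.Relation.Unary.Any using (here; there; satisfied) renaming (any? to anyˡ?)
open import Data.List.Relation.Unary.Unique.Propositional using (Unique)
open import Data.List.Relation.Unary.Unique.Propositional.Properties using (cartesianProductWith⁺)
open import Data.Nat.Base as ℕ using (ℕ; zero; suc; NonZero; _≥_)
open import Data.Nat.Properties as ℕ using (m*n≢0; n≤0⇒n≡0)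
open import Data.Product using (Σ; ∃; ∃-syntax; _×_; _,_; proj₁; proj₂)
open import Data.Rational.Base using (ℚ; 0ℚ; 1ℚ; _+_; _*_; _<_; ∣_∣; +-*-rawSemiring)
open import Data.Sum.Base using (_⊎_; inj₁; inj₂; swap)
open import Data.Vec.Base using (Vec; []; _∷_; lookup; tabulate)
open import Data.Vec.Properties using (∷-injective; lookup∘tabulate; []=⇒lookup; lookup⇒[]=)
open import Function.Base using (_∘_)
open import Function.Bundles using (_⇔_; mk⇔; module Equivalence)
open import Function.Definitions using (Injective)
open import Level using (0ℓ)
open import Relation.Binary.Core using (Rel)
open import Relation.Binary.Definitions using (Decidable; Symmetric)
open import Relation.Binary.PropositionalEquality using (_≡_; _≢_; refl; sym; trans; cong; subst; subst₂)
open import Relation.Nullary using (¬_; Dec; yes; no; does; contradiction)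
open import Relation.Nullary.Decidable using (map′; _×-dec_; _⊎-dec_; _→-dec_; ¬?; dec-true; dec-false)
import Relation.Unary as U

open import Algebra.Definitions.RawSemiring +-*-rawSemiring public using () renaming (_^_ to _^ℚ_)

private
  variable
    A : Set
    m n : ℕ

record Graph (n : ℕ) : Set₁ where
  field
    Adj       : Rel (Fin n) 0ℓ
    adj?      : Decidable Adj
    symmetric : Symmetric Adj
    loopless  : ∀ {i} → ¬ Adj i i

open Graph

symmetrise : {R : Rel (Fin n) 0ℓ} → Decidable R → Graph n
symmetrise {R = R} R? = record
  { Adj       = λ i j → i ≢ j × (R i j ⊎ R j i)
  ; adj?      = λ i j → ¬? (i ≟ᶠ j) ×-dec (R? i j ⊎-dec R? j i)
  ; symmetric = λ (i≢j , r) → i≢j ∘ sym , swap r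
  ; loopless  = λ (i≢i , _) → i≢i refl
  }

Next : Rel (Fin n) 0ℓ
Next {n} i j = toℕ j ≡ suc (toℕ i) ⊎ (suc (toℕ i) ≡ n × toℕ j ≡ 0)

next? : Decidable (Next {n})
next? {n} i j = (toℕ j ℕ.≟ suc (toℕ i)) ⊎-dec ((suc (toℕ i) ℕ.≟ n) ×-dec (toℕ j ℕ.≟ 0))

-- The cycle C_k, for k ≥ 3; for smaller k this is the complete graph on k vertices.
cycle : (k : ℕ) → Graph k
cycle k = symmetrise (next? {k})

-- A candidate subgraph of a graph on Fin n: a set of vertices together with an
-- adjacency matrix.  Once IsSubgraphOf holds, distinct values of this type are
-- distinct pairs (V , E).
record Subgraph (n : ℕ) : Set where
  constructor _,ᵍ_
  field
    vertices : Subset n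
    edges    : Vec (Subset n) n

  Edge : Rel (Fin n) 0ℓ
  Edge i j = j ∈ lookup edges i

  edge? : Decidable Edge
  edge? i j = j ∈? lookup edges i

open Subgraph

record _IsSubgraphOf_ (S : Subgraph n) (G : Graph n) : Set where
  field
    edges⊆        : ∀ i j → Edge S i j → Adj G i j
    edgeSymmetric : ∀ i j → Edge S i j → Edge S j i
    endpoint      : ∀ i j → Edge S i j → i ∈ vertices S

record _≅_ (S : Subgraph n) (H : Graph m) : Set where
  field
    to        : Fin m → Fin n
    injective : Injective _≡_ _≡_ to
    image     : ∀ v → v ∈ vertices S ⇔ (∃[ i ] to i ≡ v)
    adjacency : ∀ i j → Adj H i j ⇔ Edge S (to i) (to j)

Free : Graph m → Graph n → Set
Free F G = ¬ (∃[ S ] S IsSubgraphOf G × S ≅ F)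

allVecs : List A → (n : ℕ) → List (Vec A n)
allVecs xs zero    = [ [] ]
allVecs xs (suc n) = cartesianProductWith _∷_ xs (allVecs xs n)

allSubsets : (n : ℕ) → List (Subset n)
allSubsets = allVecs (true ∷ false ∷ [])

allMatrices : (n : ℕ) → List (Vec (Subset n) n)
allMatrices n = allVecs (allSubsets n) n

allSubgraphs : (n : ℕ) → List (Subgraph n)
allSubgraphs n = cartesianProductWith _,ᵍ_ (allSubsets n) (allMatrices n)

∈-allVecs : {xs : List A} → (∀ x → x ∈ˡ xs) → (v : Vec A n) → v ∈ˡ allVecs xs n
∈-allVecs all []      = here refl
∈-allVecs all (x ∷ v) = ∈-cartesianProductWith⁺ _∷_ (all x) (∈-allVecs all v)

∈-allSubsets : (p : Subset n) → p ∈ˡ allSubsets n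
∈-allSubsets = ∈-allVecs λ { true → here refl ; false → there (here refl) }

∈-allMatrices : (M : Vec (Subset n) n) → M ∈ˡ allMatrices n
∈-allMatrices = ∈-allVecs ∈-allSubsets

∈-allSubgraphs : (S : Subgraph n) → S ∈ˡ allSubgraphs n
∈-allSubgraphs (V ,ᵍ E) = ∈-cartesianProductWith⁺ _,ᵍ_ (∈-allSubsets V) (∈-allMatrices E)

allVecs-unique : {xs : List A} → Unique xs → ∀ n → Unique (allVecs xs n)
allVecs-unique xs! zero    = [] ∷ []
allVecs-unique xs! (suc n) = cartesianProductWith⁺ _∷_ ∷-injective xs! (allVecs-unique xs! n)

allSubgraphs-unique : ∀ n → Unique (allSubgraphs n)
allSubgraphs-unique n = cartesianProductWith⁺ _,ᵍ_ (λ { refl → refl , refl })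
  subsets! (allVecs-unique subsets! n)
  where
  subsets! : Unique (allSubsets n)
  subsets! = allVecs-unique (((λ ()) ∷ []) ∷ [] ∷ []) n

private
  ∃-dec : {xs : List A} → (∀ x → x ∈ˡ xs) → {P : A → Set} → U.Decidable P → Dec (∃ P)
  ∃-dec all P? = map′ satisfied (λ (x , px) → lose (all x) px) (anyˡ? P? _)

  _⇔-dec_ : {P Q : Set} → Dec P → Dec Q → Dec (P ⇔ Q)
  p? ⇔-dec q? = map′ (λ (f , g) → mk⇔ f g) (λ e → Equivalence.to e , Equivalence.from e)
    ((p? →-dec q?) ×-dec (q? →-dec p?))

_isSubgraphOf?_ : (S : Subgraph n) (G : Graph n) → Dec (S IsSubgraphOf G)
S isSubgraphOf? G = map′
  (λ (a , b , c) → record { edges⊆ = a ; edgeSymmetric = b ; endpoint = c })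
  (λ s → let open _IsSubgraphOf_ s in edges⊆ , edgeSymmetric , endpoint)
  (     all? (λ i → all? λ j → edge? S i j →-dec adj? G i j)
  ×-dec all? (λ i → all? λ j → edge? S i j →-dec edge? S j i)
  ×-dec all? (λ i → all? λ j → edge? S i j →-dec (i ∈? vertices S)))

_≅?_ : (S : Subgraph n) (H : Graph m) → Dec (S ≅ H)
_≅?_ {n} {m} S H = map′ fromVec toVec (∃-dec (∈-allVecs ∈-allFin) isIso?)
  where
  IsIso : Vec (Fin n) m → Set
  IsIso f = (∀ i j → lookup f i ≡ lookup f j → i ≡ j)
          × (∀ v → v ∈ vertices S ⇔ (∃[ i ] lookup f i ≡ v))
          × (∀ i j → Adj H i j ⇔ Edge S (lookup f i) (lookup f j))

  isIso? : U.Decidable IsIso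
  isIso? f = all? (λ i → all? λ j → (lookup f i ≟ᶠ lookup f j) →-dec (i ≟ᶠ j))
       ×-dec all? (λ v → (v ∈? vertices S) ⇔-dec any? λ i → lookup f i ≟ᶠ v)
       ×-dec all? (λ i → all? λ j → adj? H i j ⇔-dec edge? S (lookup f i) (lookup f j))

  fromVec : ∃ IsIso → S ≅ H
  fromVec (f , inj , im , adj) = record
    { to = lookup f ; injective = inj _ _ ; image = im ; adjacency = adj }

  toVec : S ≅ H → ∃ IsIso
  toVec iso = tabulate to
    , (λ i j e → injective (trans (sym (lt i)) (trans e (lt j))))
    , (λ v → mk⇔ (λ v∈ → let i , e = Equivalence.to (image v) v∈ in i , trans (lt i) e)
                 (λ (i , e) → Equivalence.from (image v) (i , trans (sym (lt i)) e)))
    , (λ i j → subst₂ (λ x y → Adj H i j ⇔ Edge S x y) (sym (lt i)) (sym (lt j)) (adjacency i j))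
    where
    open _≅_ iso
    lt : ∀ i → lookup (tabulate to) i ≡ to i
    lt = lookup∘tabulate to

free? : (F : Graph m) (G : Graph n) → Dec (Free F G)
free? F G = ¬? (∃-dec ∈-allSubgraphs λ S → (S isSubgraphOf? G) ×-dec (S ≅? F))

copies : Graph m → Graph n → List (Subgraph n)
copies {n = n} H G = filter (λ S → (S isSubgraphOf? G) ×-dec (S ≅? H)) (allSubgraphs n)

#copies : Graph m → Graph n → ℕ
#copies H G = length (copies H G)

allGraphs : (n : ℕ) → List (Graph n)
allGraphs n = map (λ M → symmetrise (λ i j → j ∈? lookup M i)) (allMatrices n)

-- If no n-vertex graph is F-free (F edgeless), the value is 0 by convention.
ex : ∀ {p q} → ℕ → Graph p → Graph q → ℕ
ex n H F = max 0 (map (#copies H) (filter (free? F) (allGraphs n)))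

-- allGraphs lists every graph up to pointwise equivalence of adjacency, so ex
-- is the maximum over arbitrary F-free graphs on Fin n.

_≈ᵍ_ : Graph n → Graph n → Set
G ≈ᵍ G′ = ∀ i j → Adj G i j ⇔ Adj G′ i j

allGraphs-complete : (G : Graph n) → ∃[ G′ ] G′ ∈ˡ allGraphs n × G ≈ᵍ G′
allGraphs-complete {n} G = _ , ∈-map⁺ _ (∈-allMatrices M) , λ i j → mk⇔
  (λ a → (λ { refl → loopless G a }) , inj₁ (M⁺ a))
  λ { (_ , inj₁ e) → M⁻ e ; (_ , inj₂ e) → symmetric G (M⁻ e) }
  where
  M : Vec (Subset n) n
  M = tabulate λ i → tabulate λ j → does (adj? G i j)

  entry : ∀ i j → lookup (lookup M i) j ≡ does (adj? G i j)
  entry i j = trans (cong (λ p → lookup p j) (lookup∘tabulate _ i)) (lookup∘tabulate _ j)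

  M⁺ : ∀ {i j} → Adj G i j → j ∈ lookup M i
  M⁺ {i} {j} a = lookup⇒[]= j _ (trans (entry i j) (dec-true (adj? G i j) a))

  M⁻ : ∀ {i j} → j ∈ lookup M i → Adj G i j
  M⁻ {i} {j} e with adj? G i j in eq
  ... | yes a = a
  ... | no ¬a = contradiction
    (trans (sym ([]=⇒lookup e)) (trans (entry i j) (dec-false (adj? G i j) ¬a))) λ ()

IsSubgraphOf-resp : {S : Subgraph n} {G G′ : Graph n} →
                    (∀ i j → Adj G i j → Adj G′ i j) → S IsSubgraphOf G → S IsSubgraphOf G′
IsSubgraphOf-resp G⊆G′ s = record
  { edges⊆ = λ i j e → G⊆G′ i j (edges⊆ i j e)
  ; edgeSymmetric = edgeSymmetric ; endpoint = endpoint }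
  where open _IsSubgraphOf_ s

#copies-cong : (H : Graph m) {G G′ : Graph n} → G ≈ᵍ G′ → #copies H G ≡ #copies H G′
#copies-cong {n = n} H G≈ = cong length (filter-≐ _ _
  ( (λ (s , e) → IsSubgraphOf-resp (λ i j → Equivalence.to (G≈ i j)) s , e)
  , (λ (s , e) → IsSubgraphOf-resp (λ i j → Equivalence.from (G≈ i j)) s , e))
  (allSubgraphs n))

Free-resp : (F : Graph m) {G G′ : Graph n} → G ≈ᵍ G′ → Free F G → Free F G′
Free-resp F G≈ free (S , s , e) =
  free (S , IsSubgraphOf-resp (λ i j → Equivalence.from (G≈ i j)) s , e)

#copies≤ex : ∀ {p q} (H : Graph p) (F : Graph q) (G : Graph n) →
             Free F G → #copies H G ℕ.≤ ex n H F
#copies≤ex {n} H F G free with allGraphs-complete G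
... | G′ , G′∈ , G≈ = subst (ℕ._≤ _) (sym (#copies-cong H G≈))
  (lookupᴬ (xs≤max 0 _) (∈-map⁺ (#copies H) (∈-filter⁺ (free? F) G′∈ (Free-resp F G≈ free))))

ex-attained : ∀ {p q} (H : Graph p) (F : Graph q) → (∃[ G ] Free {n = n} F G) →
              ∃[ G ] Free {n = n} F G × #copies H G ≡ ex n H F
ex-attained {n} H F (G , free)
  with argmax-sel (λ x → x) 0 (map (#copies H) (filter (free? F) (allGraphs n)))
... | inj₁ ex≡0 = G , free ,
  trans (n≤0⇒n≡0 (subst (#copies H G ℕ.≤_) ex≡0 (#copies≤ex H F G free))) (sym ex≡0)
... | inj₂ ex∈ with ∈-map⁻ (#copies H) ex∈
...   | G′ , G′∈ , ex≡ = G′ , proj₂ (∈-filter⁻ (free? F) {xs = allGraphs n} G′∈) , sym ex≡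

Null : (ℕ → ℚ) → Set
Null δ = ∀ ε → 0ℚ < ε → ∃[ N ] ∀ n → n ≥ N → ∣ δ n ∣ < ε

-- f n = (1 + o(1)) · g n as n → ∞
_~[1+o1]_ : (ℕ → ℚ) → (ℕ → ℚ) → Set
f ~[1+o1] g = ∃[ δ ] Null δ × (∃[ N ] ∀ n → n ≥ N → f n ≡ (1ℚ + δ n) * g n)

2*-nonZero : ∀ {l} → 2 ℕ.≤ l → NonZero (2 ℕ.* l)
2*-nonZero {suc l} _ = m*n≢0 2 (suc l)

{-# OPTIONS --safe #-}
module Submission where

-- Upper bound.  Let G be C₂ₖ₊₁-free on n vertices.  A path on 2k vertices inside a
-- neighbourhood closes up through its centre to a C₂ₖ₊₁, so the graph induced on
-- each neighbourhood has O(n) edges.  For a vertex v, counting the arcs (x , y) by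
-- how many of x, y lie in N(v) gives 2 P(v) ≤ E + O(n), where P(v) is the number of
-- 2-walks from v and E the number of arcs.  Summing over v and applying
-- Cauchy–Schwarz to Σ P(v) = Σ d(x)² yields E ≤ n²/2 + O(n), so P(v) ≤ n²/4 + O(n).
-- Hence there are at most E (max P)^(l-1) walks on 2l vertices, and each C₂ₗ is
-- traversed by 4l of them.
--
-- Lower bound.  In the balanced complete bipartite graph, choose the vertices of an
-- alternating path greedily; each of the 2l - 1 steps after the first has at least
-- n/2 - O(1) choices, every such path closes to a C₂ₗ, and each C₂ₗ arises 4l times.

open import Defs
open import Data.Bool.Base using (Bool; true; false; not; if_then_else_)
open import Data.Bool.Properties using (not-involutive; not-¬; ¬-not) renaming (_≟_ to _≟ᵇ_)
open import Data.Fin.Base using (Fin; toℕ; fromℕ<; fromℕ; opposite) renaming (zero to fzero; suc to fsuc)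
open import Data.Fin.Properties using (any?; toℕ-injective; toℕ<n; toℕ-fromℕ<; toℕ-fromℕ; opposite-prop; opposite-involutive) renaming (_≟_ to _≟ᶠ_)
open import Data.Fin.Subset using () renaming (_∈_ to _∈ˢ_)
open import Data.Fin.Subset.Properties using (⊆-antisym)
open import Data.List.Base using (List; []; _∷_; _++_; map; filter; length; allFin; cartesianProduct; cartesianProductWith)
open import Data.List.Membership.DecPropositional using () renaming (_∈?_ to ∈-dec)
open import Data.List.Membership.Propositional using (lose; find) renaming (_∈_ to _∈ˡ_)
open import Data.List.Membership.Propositional.Properties using (∈-∃++; ∈-++⁺ˡ; ∈-++⁺ʳ; ∈-++⁻; ∈-allFin; ∈-filter⁺; ∈-filter⁻; ∈-cartesianProduct⁺; ∈-cartesianProduct⁻)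
open import Data.List.Properties using (length-++; length-tabulate; map-tabulate; length-map; length-filter)
open import Data.List.Relation.Binary.Permutation.Propositional using (_↭_; ↭-sym)
open import Data.List.Relation.Binary.Permutation.Propositional.Properties using (∈-resp-↭; shift; ↭-length)
import Data.List.Relation.Binary.Permutation.Propositional as Perm
import Data.List.Relation.Binary.Permutation.Setoid.Properties as PermSetoid
open import Data.List.Relation.Unary.All using ([]; _∷_) renaming (lookup to lookupᴬ)
open import Data.List.Relation.Unary.AllPairs using ([]; _∷_)
open import Data.List.Relation.Unary.Any using (here; there) renaming (any? to anyˡ?)
open import Data.List.Relation.Unary.Unique.Propositional using (Unique)
import Data.List.Relation.Unary.Unique.Propositional.Properties as Unique
open import Data.Nat.Base using (ℕ; zero; suc; _≤_; _<_; z≤n; s≤s; _+_; _*_; _^_; _∸_; NonZero; ≢-nonZero)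
open import Data.Nat.DivMod using (m/n*n≤m; m*n/n≡m; /-monoˡ-≤) renaming (_/_ to _div_)
open import Data.Nat.Properties
open import Data.Nat.Tactic.RingSolver using (solve-∀)
open import Data.Product using (∃-syntax; _×_; _,_; proj₁; proj₂)
open import Data.Sum.Base using (inj₁; inj₂)
open import Data.Unit.Base using (⊤; tt)
open import Data.Vec.Base using (Vec; []; _∷_; lookup; tabulate; head; toList)
open import Data.Vec.Membership.Propositional.Properties using (∈-lookup; ∈-toList⁺)
open import Data.Vec.Properties using (length-toList; lookup∘tabulate; tabulate∘lookup; tabulate-cong; []=⇒lookup; lookup⇒[]=)
open import Data.Vec.Relation.Unary.Linked using (Linked; []; [-]; _∷_; linked?)
open import Function.Base using (_∘_; id; case_of_)
open import Function.Bundles using (_⇔_; mk⇔; module Equivalence)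
open import Relation.Binary.Core using (Rel)
open import Relation.Binary.Definitions using (Decidable; Symmetric)
open import Relation.Binary.PropositionalEquality using (_≡_; _≢_; refl; sym; trans; cong; cong₂; subst; subst₂; setoid; module ≡-Reasoning)
open import Relation.Nullary using (¬_; Dec; yes; no; does; contradiction)
open import Relation.Nullary.Decidable using (_×-dec_; ¬?; dec-true)
open import Level using (0ℓ)
import Relation.Unary as U

-- A single step of a walk may have n - 1 continuations, as at the centre of a star; only pairs of
-- steps obey a uniform bound of the right size. A walk on 2l vertices has 2l - 1 steps, so l - 1
-- pairs leave one step over, and E pays for it. The balanced complete bipartite graph attains E =
-- n²/2 and P = n²/4 up to lower order, so walks number about 2(n²/4)^l, and division by 4l gives
-- the constant. Forgetting the closing edge and allowing repeated vertices costs nothing to leading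
-- order, because almost every walk of that graph closes to a cycle. The factor 4l counts triples of
-- a copy, a start and a direction. A copy has no canonical start, so both are read off in one
-- labelling, fixed once for each copy. A relation between triples and vertex vectors, functional in
-- both directions, then serves both bounds. The estimates stay in ℕ: halves and quarters are
-- cleared by powers of 2 and 4, the relative error O(1/n) by one factor n. Rationals enter only at
-- the end.

private
  variable
    A B : Set
    m n : ℕ

-- Finite sums and indicators

Σ[_] : List A → (A → ℕ) → ℕ
Σ[ []     ] f = 0
Σ[ x ∷ xs ] f = f x + Σ[ xs ] f

Σ-cong : (xs : List A) {f g : A → ℕ} → (∀ x → f x ≡ g x) → Σ[ xs ] f ≡ Σ[ xs ] g
Σ-cong []       f≡g = refl
Σ-cong (x ∷ xs) f≡g = cong₂ _+_ (f≡g x) (Σ-cong xs f≡g)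

Σ-mono-∈ : (xs : List A) {f g : A → ℕ} → (∀ {x} → x ∈ˡ xs → f x ≤ g x) → Σ[ xs ] f ≤ Σ[ xs ] g
Σ-mono-∈ []       f≤g = z≤n
Σ-mono-∈ (x ∷ xs) f≤g = +-mono-≤ (f≤g (here refl)) (Σ-mono-∈ xs (f≤g ∘ there))

Σ-mono : (xs : List A) {f g : A → ℕ} → (∀ x → f x ≤ g x) → Σ[ xs ] f ≤ Σ[ xs ] g
Σ-mono xs f≤g = Σ-mono-∈ xs λ {x} _ → f≤g x

Σ-+ : (xs : List A) (f g : A → ℕ) → Σ[ xs ] (λ x → f x + g x) ≡ Σ[ xs ] f + Σ[ xs ] g
Σ-+ []       f g = refl
Σ-+ (x ∷ xs) f g rewrite Σ-+ xs f g = lemma (f x) (g x) (Σ[ xs ] f) (Σ[ xs ] g)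
  where
  lemma : ∀ a b c d → a + b + (c + d) ≡ a + c + (b + d)
  lemma = solve-∀

Σ-*ˡ : (xs : List A) (c : ℕ) (f : A → ℕ) → Σ[ xs ] (λ x → c * f x) ≡ c * Σ[ xs ] f
Σ-*ˡ []       c f = sym (*-zeroʳ c)
Σ-*ˡ (x ∷ xs) c f rewrite Σ-*ˡ xs c f = sym (*-distribˡ-+ c (f x) _)

Σ-*ʳ : (xs : List A) (c : ℕ) (f : A → ℕ) → Σ[ xs ] (λ x → f x * c) ≡ Σ[ xs ] f * c
Σ-*ʳ xs c f = trans (Σ-cong xs λ x → *-comm (f x) c) (trans (Σ-*ˡ xs c f) (*-comm c _))

Σ-const : (xs : List A) (c : ℕ) → Σ[ xs ] (λ _ → c) ≡ length xs * c
Σ-const []       c = refl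
Σ-const (x ∷ xs) c = cong (c +_) (Σ-const xs c)

Σ-swap : (xs : List A) (ys : List B) (f : A → B → ℕ) →
         Σ[ xs ] (λ x → Σ[ ys ] (f x)) ≡ Σ[ ys ] (λ y → Σ[ xs ] (λ x → f x y))
Σ-swap []       ys f = sym (trans (Σ-const ys 0) (*-zeroʳ (length ys)))
Σ-swap (x ∷ xs) ys f = trans (cong (Σ[ ys ] (f x) +_) (Σ-swap xs ys f)) (sym (Σ-+ ys (f x) _))

Σ-++ : (xs ys : List A) (f : A → ℕ) → Σ[ xs ++ ys ] f ≡ Σ[ xs ] f + Σ[ ys ] f
Σ-++ []       ys f = refl
Σ-++ (x ∷ xs) ys f = trans (cong (f x +_) (Σ-++ xs ys f)) (sym (+-assoc (f x) _ _))

Σ-map : (g : A → B) (xs : List A) (f : B → ℕ) → Σ[ map g xs ] f ≡ Σ[ xs ] (f ∘ g)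
Σ-map g []       f = refl
Σ-map g (x ∷ xs) f = cong (f (g x) +_) (Σ-map g xs f)

Σ-↭ : {xs ys : List A} (f : A → ℕ) → xs ↭ ys → Σ[ xs ] f ≡ Σ[ ys ] f
Σ-↭ f Perm.refl         = refl
Σ-↭ f (Perm.prep x p)   = cong (f x +_) (Σ-↭ f p)
Σ-↭ f (Perm.swap x y p) rewrite Σ-↭ f p = x∙yz≈y∙xz (f x) (f y) _
  where
  x∙yz≈y∙xz : ∀ a b c → a + (b + c) ≡ b + (a + c)
  x∙yz≈y∙xz = solve-∀
Σ-↭ f (Perm.trans p q)  = trans (Σ-↭ f p) (Σ-↭ f q)

ind : {P : Set} → Dec P → ℕ
ind P? = if does P? then 1 else 0

ind-cong : {P Q : Set} (P? : Dec P) (Q? : Dec Q) → (P → Q) → (Q → P) → ind P? ≡ ind Q?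
ind-cong (yes p) (yes q) f g = refl
ind-cong (yes p) (no ¬q) f g = contradiction (f p) ¬q
ind-cong (no ¬p) (yes q) f g = contradiction (g q) ¬p
ind-cong (no ¬p) (no ¬q) f g = refl

ind-× : {P Q : Set} (P? : Dec P) (Q? : Dec Q) → ind (P? ×-dec Q?) ≡ ind P? * ind Q?
ind-× (yes p) (yes q) = refl
ind-× (yes p) (no ¬q) = refl
ind-× (no ¬p) _       = refl

ind≤1 : {P : Set} (P? : Dec P) → ind P? ≤ 1
ind≤1 (yes _) = ≤-refl
ind≤1 (no  _) = z≤n

length-filter≡Σ : {P : A → Set} (P? : U.Decidable P) (xs : List A) →
                  length (filter P? xs) ≡ Σ[ xs ] (ind ∘ P?)
length-filter≡Σ P? []       = refl
length-filter≡Σ P? (x ∷ xs) with P? x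
... | yes _ = cong suc (length-filter≡Σ P? xs)
... | no  _ = length-filter≡Σ P? xs

Σ-filter : {P : A → Set} (P? : U.Decidable P) (xs : List A) (f : A → ℕ) →
           Σ[ filter P? xs ] f ≡ Σ[ xs ] (λ x → ind (P? x) * f x)
Σ-filter P? []       f = refl
Σ-filter P? (x ∷ xs) f with P? x
... | yes _ = cong₂ _+_ (sym (*-identityˡ (f x))) (Σ-filter P? xs f)
... | no  _ = Σ-filter P? xs f

Σ-allVecs : (xs : List A) (m : ℕ) (f : Vec A (suc m) → ℕ) →
            Σ[ allVecs xs (suc m) ] f ≡ Σ[ xs ] (λ x → Σ[ allVecs xs m ] (f ∘ (x ∷_)))
Σ-allVecs {A = A} xs m f = go xs
  where
  go : (ys : List A) → Σ[ cartesianProductWith _∷_ ys (allVecs xs m) ] f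
                     ≡ Σ[ ys ] (λ x → Σ[ allVecs xs m ] (f ∘ (x ∷_)))
  go []       = refl
  go (y ∷ ys) = trans (Σ-++ (map (y ∷_) (allVecs xs m)) _ f)
                      (cong₂ _+_ (Σ-map (y ∷_) (allVecs xs m) f) (go ys))

-- Cauchy-Schwarz and counting by injections

2ab≤a²+b² : ∀ a b → 2 * (a * b) ≤ a * a + b * b
2ab≤a²+b² zero    b       = z≤n
2ab≤a²+b² (suc a) zero    = subst (_≤ suc a * suc a + 0) (sym (cong (2 *_) (*-zeroʳ a))) z≤n
2ab≤a²+b² (suc a) (suc b) = subst₂ _≤_ (lhs a b) (rhs a b)
                              (+-monoˡ-≤ (2 * a + 2 * b + 2) (2ab≤a²+b² a b))
  where
  lhs : ∀ a b → 2 * (a * b) + (2 * a + 2 * b + 2) ≡ 2 * (suc a * suc b)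
  lhs = solve-∀
  rhs : ∀ a b → a * a + b * b + (2 * a + 2 * b + 2) ≡ suc a * suc a + suc b * suc b
  rhs = solve-∀

-- Induction on the list: the cross term of the new square is split termwise by `2ab≤a²+b²`, which
-- yields one copy of a² per old entry and the old sum of squares.
Σ-cauchySchwarz : (xs : List A) (f : A → ℕ) →
                  Σ[ xs ] f * Σ[ xs ] f ≤ length xs * Σ[ xs ] (λ x → f x * f x)
Σ-cauchySchwarz []       f = z≤n
Σ-cauchySchwarz (x ∷ xs) f = begin
  (a + s) * (a + s)                 ≡⟨ lhs a s ⟩
  a * a + (2 * (a * s) + s * s)     ≤⟨ +-monoʳ-≤ (a * a) (+-mono-≤ cross (Σ-cauchySchwarz xs f)) ⟩
  a * a + (ℓ * (a * a) + q + ℓ * q) ≡⟨ rhs a ℓ q ⟩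
  suc ℓ * (a * a + q)               ∎
  where
  open ≤-Reasoning
  a = f x
  s = Σ[ xs ] f
  q = Σ[ xs ] (λ y → f y * f y)
  ℓ = length xs
  lhs : ∀ a s → (a + s) * (a + s) ≡ a * a + (2 * (a * s) + s * s)
  lhs = solve-∀
  rhs : ∀ a ℓ q → a * a + (ℓ * (a * a) + q + ℓ * q) ≡ suc ℓ * (a * a + q)
  rhs = solve-∀
  cross : 2 * (a * s) ≤ ℓ * (a * a) + q
  cross = begin
    2 * (a * s)                     ≡⟨ *-assoc 2 a s ⟨
    2 * a * s                       ≡⟨ Σ-*ˡ xs (2 * a) f ⟨
    Σ[ xs ] (λ y → 2 * a * f y)     ≤⟨ Σ-mono xs (λ y → ≤-trans (≤-reflexive (*-assoc 2 a (f y))) (2ab≤a²+b² a (f y))) ⟩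
    Σ[ xs ] (λ y → a * a + f y * f y) ≡⟨ Σ-+ xs (λ _ → a * a) (λ y → f y * f y) ⟩
    Σ[ xs ] (λ _ → a * a) + q       ≡⟨ cong (_+ q) (Σ-const xs (a * a)) ⟩
    ℓ * (a * a) + q                 ∎

-- The matching is a relation, so a partner may come with witnesses that are no part of the counted
-- data. By injectivity the partner of `x` can be removed from `ys` without depriving any other
-- element.
length-≤-via : {R : A → B → Set} {xs : List A} {ys : List B} → Unique xs →
               (∀ {x} → x ∈ˡ xs → ∃[ y ] y ∈ˡ ys × R x y) →
               (∀ {x x′ y} → R x y → R x′ y → x ≡ x′) →
               length xs ≤ length ys
length-≤-via {xs = []} _ _ _ = z≤n
length-≤-via {R = R} {xs = x ∷ xs} (x∉ ∷ xs!) f inj with f (here refl)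
... | y , y∈ , r with ∈-∃++ y∈
... | as , bs , refl = begin
  suc (length xs)            ≤⟨ s≤s (length-≤-via xs! f′ inj) ⟩
  suc (length (as ++ bs))    ≡⟨ cong suc (length-++ as) ⟩
  suc (length as + length bs) ≡⟨ +-suc (length as) (length bs) ⟨
  length as + suc (length bs) ≡⟨ length-++ as ⟨
  length (as ++ y ∷ bs)      ∎
  where
  open ≤-Reasoning
  f′ : ∀ {x′} → x′ ∈ˡ xs → ∃[ y′ ] y′ ∈ˡ as ++ bs × R x′ y′
  f′ x′∈ with f (there x′∈)
  ... | y′ , y′∈ , r′ with ∈-++⁻ as y′∈
  ...   | inj₁ ∈as         = y′ , ∈-++⁺ˡ ∈as , r′
  ...   | inj₂ (there ∈bs) = y′ , ∈-++⁺ʳ as ∈bs , r′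
  ...   | inj₂ (here refl) = contradiction (inj r r′) (lookupᴬ x∉ x′∈)

unique⊆⇒length≤ : {xs ys : List A} → Unique xs → (∀ {x} → x ∈ˡ xs → x ∈ˡ ys) → length xs ≤ length ys
unique⊆⇒length≤ xs! xs⊆ys = length-≤-via {R = _≡_} xs! (λ x∈ → _ , xs⊆ys x∈ , refl) λ { refl refl → refl }

^-distribʳ-* : ∀ o m n → (m * n) ^ o ≡ m ^ o * n ^ o
^-distribʳ-* zero    m n = refl
^-distribʳ-* (suc o) m n rewrite ^-distribʳ-* o m n = *-interchange m n (m ^ o) (n ^ o)
  where
  *-interchange : ∀ a b c d → a * b * (c * d) ≡ a * c * (b * d)
  *-interchange = solve-∀

-- Relations without long paths are sparse

Distinct : Vec A m → Set
Distinct v = ∀ i j → lookup v i ≡ lookup v j → i ≡ j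

distinct-∷ : {x : A} {v : Vec A m} → (∀ i → lookup v i ≢ x) → Distinct v → Distinct (x ∷ v)
distinct-∷ x∉v v! fzero    fzero    e = refl
distinct-∷ x∉v v! fzero    (fsuc j) e = contradiction (sym e) (x∉v j)
distinct-∷ x∉v v! (fsuc i) fzero    e = contradiction e (x∉v i)
distinct-∷ x∉v v! (fsuc i) (fsuc j) e = cong fsuc (v! i j e)

∃-∉-vec : {xs : List (Fin n)} → Unique xs → (v : Vec (Fin n) m) → m < length xs →
          ∃[ y ] y ∈ˡ xs × (∀ i → lookup v i ≢ y)
∃-∉-vec {m = m} {xs = xs} xs! v m<xs with anyˡ? (λ y → ¬? (∈-dec _≟ᶠ_ y (toList v))) xs
... | yes p with find p
...   | y , y∈xs , y∉v = y , y∈xs , λ { i refl → y∉v (∈-toList⁺ (∈-lookup i v)) }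
∃-∉-vec {m = m} {xs = xs} xs! v m<xs | no ¬p = contradiction m<xs (≤⇒≯ xs≤m)
  where
  ⊆v : ∀ {y} → y ∈ˡ xs → y ∈ˡ toList v
  ⊆v {y} y∈xs with ∈-dec _≟ᶠ_ y (toList v)
  ... | yes y∈v = y∈v
  ... | no  y∉v = contradiction (lose y∈xs y∉v) ¬p
  xs≤m : length xs ≤ m
  xs≤m = subst (length xs ≤_) (length-toList v) (unique⊆⇒length≤ xs! ⊆v)

module _ {R : Rel (Fin n) 0ℓ} (R? : Decidable R) (R-sym : Symmetric R) where

  degree : List (Fin n) → Fin n → ℕ
  degree U x = Σ[ U ] (λ y → ind (R? x y))

  PathIn : List (Fin n) → ℕ → Set
  PathIn U m = ∃[ p ] (Linked R {m} p × Distinct p × (∀ i → lookup p i ∈ˡ U))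

  -- The path grows at its head, whose at least `L` neighbours in `U` cannot all lie among fewer
  -- than `L` path vertices.
  minDegree⇒path : {U : List (Fin n)} → Unique U → ∀ L → (∀ {x} → x ∈ˡ U → L ≤ degree U x) →
                   ∀ {x} → x ∈ˡ U → ∀ m → m < L → PathIn U (suc m)
  minDegree⇒path U! L deg≥L {x} x∈U zero m<L =
    x ∷ [] , [-] , (λ { fzero fzero _ → refl }) , λ { fzero → x∈U }
  minDegree⇒path {U} U! L deg≥L x∈U (suc m) m<L
    with minDegree⇒path U! L deg≥L x∈U m (<-trans (n<1+n m) m<L)
  ... | p@(z ∷ _) , p-linked , p! , p⊆U
    with ∃-∉-vec (Unique.filter⁺ (R? z) U!) p
           (≤-trans m<L (≤-trans (deg≥L (p⊆U fzero)) (≤-reflexive (sym (length-filter≡Σ (R? z) U)))))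
  ... | y , y∈ , y∉p with ∈-filter⁻ (R? z) {xs = U} y∈
  ...   | y∈U , z~y = y ∷ p , R-sym z~y ∷ p-linked , distinct-∷ y∉p p!
                    , λ { fzero → y∈U ; (fsuc i) → p⊆U i }

  -- Delete vertices of degree below L one at a time; if none remains, a path
  -- can be extended greedily.
  pathless⇒sparse : ∀ L → 1 ≤ L → {U : List (Fin n)} → Unique U → ¬ PathIn U L →
                    Σ[ U ] (degree U) ≤ length U * (2 * L)
  pathless⇒sparse L@(suc L′) _ U! ¬path = go _ U! refl ¬path
    where
    go : ∀ u {U} → Unique U → length U ≡ u → ¬ PathIn U L → Σ[ U ] (degree U) ≤ u * (2 * L)
    go u       {[]}        U! eq   ¬path = z≤n
    go (suc u) {U@(w ∷ _)} U! |U| ¬path with anyˡ? (λ x → degree U x <? L) U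
    ... | no ¬p = contradiction
      (minDegree⇒path U! L (λ x∈ → ≮⇒≥ (λ d<L → ¬p (lose x∈ d<L))) {w} (here refl) L′ ≤-refl) ¬path
    ... | yes p with find p
    ...   | x , x∈U , d<L with ∈-∃++ x∈U
    ...     | as , bs , eq = begin
      Σ[ U ] (degree U)                                     ≡⟨ Σ-↭ (degree U) U↭ ⟩
      degree U x + Σ[ V ] (degree U)                        ≡⟨ cong (λ t → degree U x + t) (Σ-cong V λ y → Σ-↭ (λ z → ind (R? y z)) U↭) ⟩
      degree U x + Σ[ V ] (λ y → ind (R? y x) + degree V y) ≡⟨ cong (λ t → degree U x + t) (Σ-+ V _ (degree V)) ⟩
      degree U x + (Σ[ V ] (λ y → ind (R? y x)) + Σ[ V ] (degree V))
        -- Degrees count ordered pairs: deleting `x` loses the arcs out of it and the arcs into it,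
        -- at most `L` of each. Hence the constant `2 * L`.
        ≤⟨ +-mono-≤ (<⇒≤ d<L) (+-mono-≤ into≤ (go u V! V-length (λ (q , ql , q! , q⊆) → ¬path (q , ql , q! , λ i → V⊆U (q⊆ i))))) ⟩
      L + (L + u * (2 * L))                                 ≡⟨ arith L u ⟩
      suc u * (2 * L)                                       ∎
      where
      open ≤-Reasoning
      V = as ++ bs
      U↭ : U ↭ x ∷ V
      U↭ = subst (_↭ x ∷ V) (sym eq) (shift x as bs)
      xV! : Unique (x ∷ V)
      xV! = PermSetoid.Unique-resp-↭ (setoid (Fin n)) (Perm.↭⇒↭ₛ U↭) U!
      V! : Unique V
      V! = case xV! of λ { (_ ∷ v!) → v! }
      V-length : length V ≡ u
      V-length = suc-injective (trans (sym (↭-length U↭)) |U|)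
      V⊆U : ∀ {y} → y ∈ˡ V → y ∈ˡ U
      V⊆U y∈ = ∈-resp-↭ (↭-sym U↭) (there y∈)
      into≤ : Σ[ V ] (λ y → ind (R? y x)) ≤ L
      into≤ = begin
        Σ[ V ] (λ y → ind (R? y x)) ≡⟨ Σ-cong V (λ y → ind-cong (R? y x) (R? x y) R-sym R-sym) ⟩
        degree V x                  ≤⟨ m≤n+m _ (ind (R? x x)) ⟩
        degree (x ∷ V) x            ≡⟨ Σ-↭ (λ z → ind (R? x z)) U↭ ⟨
        degree U x                  ≤⟨ <⇒≤ d<L ⟩
        L                           ∎
      arith : ∀ L u → L + (L + u * (2 * L)) ≡ suc u * (2 * L)
      arith = solve-∀

-- Counting walks when neighbourhoods are sparse

module _ {n : ℕ} {R : Rel (Fin n) 0ℓ} (R? : Decidable R) (R-sym : Symmetric R) where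

  private
    V : List (Fin n)
    V = allFin n

    a : Fin n → Fin n → ℕ
    a x y = ind (R? x y)

    a-sym : ∀ x y → a x y ≡ a y x
    a-sym x y = ind-cong (R? x y) (R? y x) R-sym R-sym

    deg : Fin n → ℕ
    deg = degree R? R-sym V

    |V| : length V ≡ n
    |V| = length-tabulate id

  neighbours : Fin n → List (Fin n)
  neighbours v = filter (R? v) V

  linkArcs : Fin n → ℕ
  linkArcs v = Σ[ neighbours v ] (degree R? R-sym (neighbours v))

  -- Ordered pairs, hence twice the number of edges; the bound to aim at is n²/2.
  arcs : ℕ
  arcs = Σ[ V ] deg

  2-walks : Fin n → ℕ
  2-walks v = Σ[ V ] (λ x → a v x * deg x)

  linkArcs≡ : ∀ v → linkArcs v ≡ Σ[ V ] (λ x → Σ[ V ] (λ y → a v x * (a v y * a x y)))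
  linkArcs≡ v = trans (Σ-filter (R? v) V _) (Σ-cong V λ x →
    trans (cong (a v x *_) (Σ-filter (R? v) V (a x))) (sym (Σ-*ˡ V (a v x) _)))

  -- An arc with p of its tail and q of its head in the neighbourhood of v
  -- satisfies p + q ≤ 1 + p q.
  2*2-walks≤ : ∀ v → 2 * 2-walks v ≤ arcs + linkArcs v
  2*2-walks≤ v = begin
    2 * 2-walks v                                        ≡⟨ cong (λ t → 2-walks v + t) (+-identityʳ (2-walks v)) ⟩
    2-walks v + 2-walks v                                ≡⟨ cong₂ _+_ out into ⟩
    ΣΣ (λ x y → a v x * a x y) + ΣΣ (λ x y → a v y * a x y) ≡⟨ ΣΣ-+ (λ x y → a v x * a x y) (λ x y → a v y * a x y) ⟨
    ΣΣ (λ x y → a v x * a x y + a v y * a x y)           ≤⟨ Σ-mono V (λ x → Σ-mono V λ y → pointwise (a v x) (a v y) (a x y) (ind≤1 (R? v x)) (ind≤1 (R? v y))) ⟩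
    ΣΣ (λ x y → a x y + a v x * (a v y * a x y))         ≡⟨ ΣΣ-+ a (λ x y → a v x * (a v y * a x y)) ⟩
    arcs + ΣΣ (λ x y → a v x * (a v y * a x y))          ≡⟨ cong (λ t → arcs + t) (linkArcs≡ v) ⟨
    arcs + linkArcs v                                    ∎
    where
    open ≤-Reasoning
    ΣΣ : (Fin n → Fin n → ℕ) → ℕ
    ΣΣ f = Σ[ V ] (λ x → Σ[ V ] (f x))
    ΣΣ-+ : ∀ f g → ΣΣ (λ x y → f x y + g x y) ≡ ΣΣ f + ΣΣ g
    ΣΣ-+ f g = trans (Σ-cong V λ x → Σ-+ V (f x) (g x)) (Σ-+ V _ _)
    out : 2-walks v ≡ ΣΣ (λ x y → a v x * a x y)
    out = Σ-cong V λ x → sym (Σ-*ˡ V (a v x) (a x))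
    -- Reversing every arc exchanges tails and heads, so the same number counts the arcs whose head
    -- is a neighbour of `v`.
    into : 2-walks v ≡ ΣΣ (λ x y → a v y * a x y)
    into = trans out (trans (Σ-swap V V _)
      (Σ-cong V λ y → Σ-cong V λ x → cong (a v x *_) (a-sym x y)))
    pointwise : ∀ p q r → p ≤ 1 → q ≤ 1 → p * r + q * r ≤ r + p * (q * r)
    pointwise zero          q r p≤1 q≤1 = *-monoˡ-≤ r q≤1
    pointwise (suc zero)    q r p≤1 q≤1 = ≤-reflexive (cong₂ _+_ (+-identityʳ r) (sym (+-identityʳ (q * r))))
    pointwise (suc (suc p)) q r (s≤s ()) q≤1

  Σ2-walks≡ : Σ[ V ] 2-walks ≡ Σ[ V ] (λ x → deg x * deg x)
  Σ2-walks≡ = trans (Σ-swap V V _) (Σ-cong V λ x →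
    trans (Σ-*ʳ V (deg x) _) (cong (_* deg x) (Σ-cong V λ v → a-sym v x)))

  2*arcs≤ : ∀ c → (∀ v → linkArcs v ≤ c * n) → 2 * arcs ≤ n * n + 2 * (c * n)
  2*arcs≤ c link≤ with 2 * arcs ≤? n * n
  ... | yes E≤ = ≤-trans E≤ (m≤m+n (n * n) _)
  -- Summation over all vertices gives 2E² ≤ n²E + n²·cn. In this case n² ≤ 2E turns the factor n²
  -- of the error into 2E, so that E can be cancelled; it is nonzero, as E = 0 would fall under the
  -- other case.
  ... | no  E≰ = *-cancelʳ-≤ (2 * arcs) (n * n + 2 * (c * n)) arcs {{arcs≢0}} (begin
    2 * arcs * arcs                            ≡⟨ *-assoc 2 arcs arcs ⟩
    2 * (arcs * arcs)                          ≤⟨ *-monoʳ-≤ 2 (Σ-cauchySchwarz V deg) ⟩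
    2 * (length V * Σ[ V ] (λ x → deg x * deg x)) ≡⟨ cong₂ (λ t s → 2 * (t * s)) |V| (sym Σ2-walks≡) ⟩
    2 * (n * Σ[ V ] 2-walks)                   ≡⟨ x∙yz≡y∙xz 2 n _ ⟩
    n * (2 * Σ[ V ] 2-walks)                   ≡⟨ cong (n *_) (Σ-*ˡ V 2 2-walks) ⟨
    n * Σ[ V ] (λ v → 2 * 2-walks v)           ≤⟨ *-monoʳ-≤ n (Σ-mono V λ v → ≤-trans (2*2-walks≤ v) (+-monoʳ-≤ arcs (link≤ v))) ⟩
    n * Σ[ V ] (λ v → arcs + c * n)            ≡⟨ cong (n *_) (trans (Σ-const V _) (cong (_* (arcs + c * n)) |V|)) ⟩
    n * (n * (arcs + c * n))                   ≡⟨ expand n arcs (c * n) ⟩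
    n * n * arcs + n * n * (c * n)             ≤⟨ +-monoʳ-≤ (n * n * arcs) (*-monoˡ-≤ (c * n) (<⇒≤ (≰⇒> E≰))) ⟩
    n * n * arcs + 2 * arcs * (c * n)          ≡⟨ collect (n * n) arcs (c * n) ⟩
    (n * n + 2 * (c * n)) * arcs               ∎)
    where
    open ≤-Reasoning
    x∙yz≡y∙xz : ∀ x y z → x * (y * z) ≡ y * (x * z)
    x∙yz≡y∙xz = solve-∀
    expand : ∀ n e d → n * (n * (e + d)) ≡ n * n * e + n * n * d
    expand = solve-∀
    collect : ∀ q e d → q * e + 2 * e * d ≡ (q + 2 * d) * e
    collect = solve-∀
    arcs≢0 : NonZero arcs
    arcs≢0 = ≢-nonZero λ e → E≰ (subst (λ t → 2 * t ≤ n * n) (sym e) z≤n)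

  4*2-walks≤ : ∀ c → (∀ v → linkArcs v ≤ c * n) → ∀ v → 4 * 2-walks v ≤ n * n + 4 * (c * n)
  4*2-walks≤ c link≤ v = begin
    4 * 2-walks v                         ≡⟨ *-assoc 2 2 (2-walks v) ⟩
    2 * (2 * 2-walks v)                   ≤⟨ *-monoʳ-≤ 2 (2*2-walks≤ v) ⟩
    2 * (arcs + linkArcs v)               ≡⟨ *-distribˡ-+ 2 arcs (linkArcs v) ⟩
    2 * arcs + 2 * linkArcs v             ≤⟨ +-mono-≤ (2*arcs≤ c link≤) (*-monoʳ-≤ 2 (link≤ v)) ⟩
    n * n + 2 * (c * n) + 2 * (c * n)     ≡⟨ arith (n * n) (c * n) ⟩
    n * n + 4 * (c * n)                   ∎
    where
    open ≤-Reasoning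
    arith : ∀ q d → q + 2 * d + 2 * d ≡ q + 4 * d
    arith = solve-∀

  private
    linked : {m : ℕ} → Vec (Fin n) m → ℕ
    linked v = ind (linked? R? v)

    -- The number `m` counts steps, so these walks have `suc m` vertices.
    walksFrom : ℕ → Fin n → ℕ
    walksFrom m x = Σ[ allVecs V m ] (λ v → linked (x ∷ v))

    linked-∷∷ : ∀ {m} x y (v : Vec (Fin n) m) → linked (x ∷ y ∷ v) ≡ a x y * linked (y ∷ v)
    linked-∷∷ x y v = ind-× (R? x y) (linked? R? (y ∷ v))

    walksFrom-suc : ∀ m x → walksFrom (suc m) x ≡ Σ[ V ] (λ y → a x y * walksFrom m y)
    walksFrom-suc m x = trans (Σ-allVecs V m (λ v → linked (x ∷ v)))
      (Σ-cong V λ y → trans (Σ-cong (allVecs V m) (linked-∷∷ x y)) (Σ-*ˡ (allVecs V m) (a x y) _))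

    -- Steps are taken in pairs because one step is bounded only by a degree, which may be close to
    -- n, whereas a pair is bounded by P, about n²/4.
    walksFrom-2+ : ∀ {P M} m → (∀ v → 2-walks v ≤ P) → (∀ v → walksFrom m v ≤ M) →
                   ∀ x → walksFrom (2 + m) x ≤ P * M
    walksFrom-2+ {P} {M} m walks≤ ≤M x = begin
      walksFrom (2 + m) x                    ≡⟨ walksFrom-suc (suc m) x ⟩
      Σ[ V ] (λ y → a x y * walksFrom (1 + m) y) ≤⟨ Σ-mono V (λ y → *-monoʳ-≤ (a x y) (one y)) ⟩
      Σ[ V ] (λ y → a x y * (deg y * M))     ≡⟨ Σ-cong V (λ y → sym (*-assoc (a x y) (deg y) M)) ⟩
      Σ[ V ] (λ y → a x y * deg y * M)       ≡⟨ Σ-*ʳ V M _ ⟩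
      2-walks x * M                          ≤⟨ *-monoˡ-≤ M (walks≤ x) ⟩
      P * M                                  ∎
      where
      open ≤-Reasoning
      one : ∀ y → walksFrom (suc m) y ≤ deg y * M
      one y = begin
        walksFrom (suc m) y                  ≡⟨ walksFrom-suc m y ⟩
        Σ[ V ] (λ z → a y z * walksFrom m z) ≤⟨ Σ-mono V (λ z → *-monoʳ-≤ (a y z) (≤M z)) ⟩
        Σ[ V ] (λ z → a y z * M)             ≡⟨ Σ-*ʳ V M (a y) ⟩
        deg y * M                            ∎

    walksFrom-even : ∀ {P} → (∀ v → 2-walks v ≤ P) → ∀ j x → walksFrom (j * 2) x ≤ P ^ j
    walksFrom-even walks≤ zero    x = ≤-refl
    walksFrom-even walks≤ (suc j) x = walksFrom-2+ (j * 2) walks≤ (walksFrom-even walks≤ j) x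

  walks : ∀ m → List (Vec (Fin n) m)
  walks m = filter (linked? R?) (allVecs V m)

  -- With Q = n² + 4cn, the single first step contributes E ≤ Q/2 and each of the `j` later pairs at
  -- most Q/4. The product is 2(Q/4)^(j+1), with denominators cleared.
  4^j*walks≤ : ∀ c → (∀ v → linkArcs v ≤ c * n) → ∀ j →
               4 ^ suc j * length (walks (suc j * 2)) ≤ 2 * (n * n + 4 * (c * n)) ^ suc j
  4^j*walks≤ c link≤ j = begin
    4 ^ suc j * length (walks (suc j * 2)) ≤⟨ *-monoʳ-≤ (4 ^ suc j) count ⟩
    4 * 4 ^ j * (arcs * P ^ j)             ≡⟨ arith (4 ^ j) arcs (P ^ j) ⟩
    2 * (2 * arcs) * (4 ^ j * P ^ j)       ≡⟨ cong (λ t → 2 * (2 * arcs) * t) (^-distribʳ-* j 4 P) ⟨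
    2 * (2 * arcs) * (4 * P) ^ j           ≤⟨ *-mono-≤ (*-monoʳ-≤ 2 2arcs≤Q) (^-monoˡ-≤ j 4P≤Q) ⟩
    2 * Q * Q ^ j                          ≡⟨ *-assoc 2 Q (Q ^ j) ⟩
    2 * Q ^ suc j                          ∎
    where
    open ≤-Reasoning
    Q = n * n + 4 * (c * n)
    -- Rounding down is harmless: 2-walk counts are integers, and 4 * `P` does not exceed `Q`.
    P = Q div 4
    4P≤Q : 4 * P ≤ Q
    4P≤Q = subst (_≤ Q) (*-comm P 4) (m/n*n≤m Q 4)
    2arcs≤Q : 2 * arcs ≤ Q
    2arcs≤Q = ≤-trans (2*arcs≤ c link≤) (+-monoʳ-≤ (n * n) (*-monoˡ-≤ (c * n) (m≤m+n 2 2)))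
    2-walks≤P : ∀ v → 2-walks v ≤ P
    2-walks≤P v = subst (_≤ P) (m*n/n≡m (2-walks v) 4)
      (/-monoˡ-≤ 4 (subst (_≤ Q) (*-comm 4 (2-walks v)) (4*2-walks≤ c link≤ v)))
    count : length (walks (suc j * 2)) ≤ arcs * P ^ j
    count = begin
      length (walks (suc j * 2))           ≡⟨ length-filter≡Σ (linked? R?) (allVecs V (suc j * 2)) ⟩
      Σ[ allVecs V (suc j * 2) ] linked    ≡⟨ Σ-allVecs V (suc (j * 2)) linked ⟩
      Σ[ V ] (walksFrom (suc (j * 2)))     ≡⟨ Σ-cong V (walksFrom-suc (j * 2)) ⟩
      Σ[ V ] (λ x → Σ[ V ] (λ y → a x y * walksFrom (j * 2) y))
        ≤⟨ Σ-mono V (λ x → Σ-mono V λ y → *-monoʳ-≤ (a x y) (walksFrom-even 2-walks≤P j y)) ⟩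
      Σ[ V ] (λ x → Σ[ V ] (λ y → a x y * P ^ j)) ≡⟨ Σ-cong V (λ x → Σ-*ʳ V (P ^ j) (a x)) ⟩
      Σ[ V ] (λ x → deg x * P ^ j)         ≡⟨ Σ-*ʳ V (P ^ j) deg ⟩
      arcs * P ^ j                         ∎
    arith : ∀ k e p → 4 * k * (e * p) ≡ 2 * (2 * e) * (k * p)
    arith = solve-∀

-- Subgraphs as images of labellings

infix 4 _↪_via_

-- The image of f need not be an induced subgraph of G.
_↪_via_ : Graph m → Graph n → (Fin m → Fin n) → Set
H ↪ G via f = (∀ i j → f i ≡ f j → i ≡ j) × (∀ i j → Graph.Adj H i j → Graph.Adj G (f i) (f j))

∈-tabulate : {P : Fin n → Set} (P? : U.Decidable P) → ∀ v → v ∈ˢ tabulate (does ∘ P?) ⇔ P v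
∈-tabulate P? v = mk⇔ to from
  where
  entry : lookup (tabulate (does ∘ P?)) v ≡ does (P? v)
  entry = lookup∘tabulate (does ∘ P?) v
  to : v ∈ˢ tabulate (does ∘ P?) → _
  to v∈ with P? v in eq
  ... | yes p = p
  ... | no ¬p = contradiction (trans (sym ([]=⇒lookup v∈)) (trans entry (cong does eq))) λ ()
  from : _ → v ∈ˢ tabulate (does ∘ P?)
  from p = lookup⇒[]= v _ (trans entry (dec-true (P? v) p))

lookup-extensional : (v w : Vec A n) → (∀ i → lookup v i ≡ lookup w i) → v ≡ w
lookup-extensional v w eq =
  trans (sym (tabulate∘lookup v)) (trans (tabulate-cong eq) (tabulate∘lookup w))

module _ (H : Graph m) {n : ℕ} (f : Fin m → Fin n) where

  private
    ∈vertices? : U.Decidable (λ v → ∃[ i ] f i ≡ v)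
    ∈vertices? v = any? λ i → f i ≟ᶠ v

    IsEdge : Fin n → Fin n → Set
    IsEdge v w = ∃[ i ] ∃[ j ] (f i ≡ v × f j ≡ w × Graph.Adj H i j)

    isEdge? : Decidable IsEdge
    isEdge? v w = any? λ i → any? λ j → (f i ≟ᶠ v) ×-dec (f j ≟ᶠ w) ×-dec Graph.adj? H i j

  image : Subgraph n
  image = tabulate (does ∘ ∈vertices?) ,ᵍ tabulate (λ v → tabulate (does ∘ isEdge? v))

  private
    edge⇔ : ∀ v w → Subgraph.Edge image v w ⇔ IsEdge v w
    edge⇔ v w = subst (λ p → w ∈ˢ p ⇔ IsEdge v w) (sym (lookup∘tabulate (λ v → tabulate (does ∘ isEdge? v)) v))
                  (∈-tabulate (isEdge? v) w)

    vertex⇔ : ∀ v → v ∈ˢ Subgraph.vertices image ⇔ (∃[ i ] f i ≡ v)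
    vertex⇔ = ∈-tabulate ∈vertices?

  image-⊆ : {G : Graph n} → H ↪ G via f → image IsSubgraphOf G
  image-⊆ {G} (f-inj , f-hom) = record
    { edges⊆        = λ v w e → case Equivalence.to (edge⇔ v w) e of λ { (i , j , refl , refl , a) → f-hom i j a }
    ; edgeSymmetric = λ v w e → case Equivalence.to (edge⇔ v w) e of λ { (i , j , p , q , a) →
                        Equivalence.from (edge⇔ w v) (j , i , q , p , Graph.symmetric H a) }
    ; endpoint      = λ v w e → case Equivalence.to (edge⇔ v w) e of λ { (i , j , p , q , a) →
                        Equivalence.from (vertex⇔ v) (i , p) }
    }

  image-≅ : (∀ i j → f i ≡ f j → i ≡ j) → image ≅ H
  image-≅ f-inj = record
    { to        = f
    ; injective = f-inj _ _
    ; image     = vertex⇔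
    ; adjacency = λ i j → mk⇔ (λ a → Equivalence.from (edge⇔ (f i) (f j)) (i , j , refl , refl , a))
        λ e → case Equivalence.to (edge⇔ (f i) (f j)) e of λ { (i′ , j′ , p , q , a) →
          subst₂ (Graph.Adj H) (f-inj _ _ p) (f-inj _ _ q) a }
    }

module _ {H : Graph m} {G : Graph n} where

  ⊆-vertices : {S T : Subgraph n} (φ : S ≅ H) (ψ : T ≅ H) → (∀ i → _≅_.to φ i ≡ _≅_.to ψ i) →
               ∀ {v} → v ∈ˢ Subgraph.vertices S → v ∈ˢ Subgraph.vertices T
  ⊆-vertices φ ψ φ≗ψ {v} v∈S with Equivalence.to (_≅_.image φ v) v∈S
  ... | i , refl = Equivalence.from (_≅_.image ψ v) (i , sym (φ≗ψ i))

  -- An isomorphism controls edges between labelled vertices only; `endpoint`, used at both ends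
  -- through symmetry, shows that `S` has no others.
  ⊆-edges : {S T : Subgraph n} → S IsSubgraphOf G → (φ : S ≅ H) (ψ : T ≅ H) →
            (∀ i → _≅_.to φ i ≡ _≅_.to ψ i) → ∀ {v w} → Subgraph.Edge S v w → Subgraph.Edge T v w
  ⊆-edges {T = T} S⊆G φ ψ φ≗ψ {v} {w} e
    with Equivalence.to (_≅_.image φ v) (endpoint v w e)
       | Equivalence.to (_≅_.image φ w) (endpoint w v (edgeSymmetric v w e))
    where open _IsSubgraphOf_ S⊆G
  ... | i , refl | j , refl = subst₂ (Subgraph.Edge T) (sym (φ≗ψ i)) (sym (φ≗ψ j))
    (Equivalence.to (_≅_.adjacency ψ i j) (Equivalence.from (_≅_.adjacency φ i j) e))

  ≅-determines : {S T : Subgraph n} → S IsSubgraphOf G → T IsSubgraphOf G → (φ : S ≅ H) (ψ : T ≅ H) →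
                 (∀ i → _≅_.to φ i ≡ _≅_.to ψ i) → S ≡ T
  ≅-determines {S} {T} S⊆G T⊆G φ ψ φ≗ψ = cong₂ _,ᵍ_
    (⊆-antisym (⊆-vertices φ ψ φ≗ψ) (⊆-vertices ψ φ (sym ∘ φ≗ψ)))
    (lookup-extensional _ _ λ v →
      ⊆-antisym (⊆-edges {S} {T} S⊆G φ ψ φ≗ψ) (⊆-edges {T} {S} T⊆G ψ φ (sym ∘ φ≗ψ)))

-- Sealed, so that the type checker never unfolds the enumeration of subgraphs.
abstract
  copyList : Graph m → Graph n → List (Subgraph n)
  copyList = copies

  copyCount : Graph m → Graph n → ℕ
  copyCount = #copies

  length-copyList : (H : Graph m) (G : Graph n) → length (copyList H G) ≡ copyCount H G
  length-copyList H G = refl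

  copyList-unique : (H : Graph m) (G : Graph n) → Unique (copyList H G)
  copyList-unique {n = n} H G = Unique.filter⁺ (λ S → (S isSubgraphOf? G) ×-dec (S ≅? H)) (allSubgraphs-unique n)

  ∈-copyList⁺ : (H : Graph m) {G : Graph n} {S : Subgraph n} →
                S IsSubgraphOf G → S ≅ H → S ∈ˡ copyList H G
  ∈-copyList⁺ H {G} {S} S⊆G φ =
    ∈-filter⁺ (λ S → (S isSubgraphOf? G) ×-dec (S ≅? H)) (∈-allSubgraphs S) (S⊆G , φ)

  ∈-copyList⁻ : (H : Graph m) {G : Graph n} {S : Subgraph n} →
                S ∈ˡ copyList H G → S IsSubgraphOf G × S ≅ H
  ∈-copyList⁻ {n = n} H {G} S∈ =
    proj₂ (∈-filter⁻ (λ S → (S isSubgraphOf? G) ×-dec (S ≅? H)) {xs = allSubgraphs n} S∈)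

  decide≅ : (S : Subgraph n) (H : Graph m) → Dec (S ≅ H)
  decide≅ = _≅?_

  extremal : {p q : ℕ} → ℕ → Graph p → Graph q → ℕ
  extremal = ex

  extremal≡ : {p q : ℕ} (n : ℕ) (H : Graph p) (F : Graph q) → extremal n H F ≡ ex n H F
  extremal≡ n H F = refl

  copyCount≤extremal : {p q : ℕ} (H : Graph p) (F : Graph q) (G : Graph n) →
                       Free F G → copyCount H G ≤ extremal n H F
  copyCount≤extremal = #copies≤ex

  extremal-attained : {p q : ℕ} (H : Graph p) (F : Graph q) → (∃[ G ] Free {n = n} F G) →
                      ∃[ G ] Free {n = n} F G × copyCount H G ≡ extremal n H F
  extremal-attained = ex-attained

-- Dihedral symmetry of the cycle

next-functional : {i j k : Fin n} → Next i j → Next i k → j ≡ k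
next-functional (inj₁ p)       (inj₁ q)       = toℕ-injective (trans p (sym q))
next-functional {j = j} (inj₁ p) (inj₂ (q , _)) = contradiction (trans p q) (<⇒≢ (toℕ<n j))
next-functional {k = k} (inj₂ (p , _)) (inj₁ q) = contradiction (trans q p) (<⇒≢ (toℕ<n k))
next-functional (inj₂ (_ , p)) (inj₂ (_ , q)) = toℕ-injective (trans p (sym q))

next-injective : {i j k : Fin n} → Next i k → Next j k → i ≡ j
next-injective (inj₁ p)       (inj₁ q)       = toℕ-injective (suc-injective (trans (sym p) q))
next-injective (inj₁ p)       (inj₂ (_ , q)) = contradiction (trans (sym p) q) λ ()
next-injective (inj₂ (_ , p)) (inj₁ q)       = contradiction (trans (sym q) p) λ ()
next-injective (inj₂ (p , _)) (inj₂ (q , _)) = toℕ-injective (suc-injective (trans p (sym q)))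

next : ∀ i → ∃[ j ] Next {suc n} i j
next {n} i with suc (toℕ i) <? suc n
... | yes i+1<n = fromℕ< i+1<n , inj₁ (toℕ-fromℕ< i+1<n)
... | no  i+1≮n = fzero , inj₂ (≤-antisym (toℕ<n i) (≮⇒≥ i+1≮n) , refl)

previous : ∀ j → ∃[ i ] Next {suc n} i j
previous {n} fzero = fromℕ< (n<1+n n) , inj₂ (cong suc (toℕ-fromℕ< (n<1+n n)) , refl)
previous {n} (fsuc j) = fromℕ< j<n , inj₁ (cong suc (sym (toℕ-fromℕ< j<n)))
  where
  j<n : toℕ j < suc n
  j<n = m<n⇒m<1+n (toℕ<n j)

opposite+suc : (i : Fin n) → toℕ (opposite i) + suc (toℕ i) ≡ n
opposite+suc i = trans (cong (_+ suc (toℕ i)) (opposite-prop i)) (m∸n+n≡m (toℕ<n i))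

next-opposite : {i j : Fin n} → Next i j → Next (opposite j) (opposite i)
next-opposite {n} {i} {j} (inj₁ p) = inj₁ (+-cancelʳ-≡ (suc (toℕ i)) _ _ (begin
  toℕ (opposite i) + suc (toℕ i)       ≡⟨ opposite+suc i ⟩
  n                                    ≡⟨ opposite+suc j ⟨
  toℕ (opposite j) + suc (toℕ j)       ≡⟨ +-suc (toℕ (opposite j)) (toℕ j) ⟩
  suc (toℕ (opposite j)) + toℕ j       ≡⟨ cong (λ t → suc (toℕ (opposite j)) + t) p ⟩
  suc (toℕ (opposite j)) + suc (toℕ i) ∎))
  where open ≡-Reasoning
next-opposite {n} {i} {j} (inj₂ (p , q)) = inj₂
  ( trans (trans (+-comm 1 _) (cong (λ t → toℕ (opposite j) + suc t) (sym q))) (opposite+suc j)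
  , +-cancelʳ-≡ (suc (toℕ i)) (toℕ (opposite i)) 0 (trans (opposite+suc i) (sym p)))

module Cyclic (m : ℕ) where

  N : ℕ
  N = suc (suc (suc m))

  1st 2nd : Fin N
  1st = fzero
  2nd = fsuc fzero

  -- Three vertices are needed: on two, each is the successor of the other. Asymmetry is what makes
  -- the two directions of traversal different.
  next-asymmetric : {i j : Fin N} → Next i j → ¬ Next j i
  next-asymmetric {i} {j} (inj₁ p) (inj₁ q) = <⇒≢ (n≤1+n _) (trans q (cong suc p))
  next-asymmetric (inj₁ p) (inj₂ (q , r)) =
    contradiction (trans (cong suc (sym (trans p (cong suc r)))) q) λ ()
  next-asymmetric (inj₂ (p , q)) (inj₁ r) =
    contradiction (trans (cong suc (sym (trans r (cong suc q)))) p) λ ()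
  next-asymmetric (inj₂ (p , q)) (inj₂ (r , s)) = contradiction (trans (cong suc (sym q)) r) λ ()

  next-irreflexive : {i j : Fin N} → Next i j → i ≢ j
  next-irreflexive i→j refl = next-asymmetric i→j i→j

  open Graph (cycle N) using () renaming (Adj to Adjᶜ)

  next⇒adj : {i j : Fin N} → Next i j → Adjᶜ i j
  next⇒adj i→j = next-irreflexive i→j , inj₁ i→j

  next⇒adj′ : {i j : Fin N} → Next i j → Adjᶜ j i
  next⇒adj′ i→j = next-irreflexive i→j ∘ sym , inj₂ i→j

  Turn : Bool → Fin N → Fin N → Set
  Turn true  i x = Next i x
  Turn false i x = Next x i

  turn-unique : ∀ b c {i x} → Turn b i x → Turn c i x → b ≡ c
  turn-unique true  true  p q = refl
  turn-unique true  false p q = contradiction q (next-asymmetric p)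
  turn-unique false true  p q = contradiction p (next-asymmetric q)
  turn-unique false false p q = refl

  turn-functional : ∀ b {i x y} → Turn b i x → Turn b i y → x ≡ y
  turn-functional true  = next-functional
  turn-functional false = next-injective

  adj⇒turn : ∀ {i x} → Adjᶜ i x → ∃[ b ] Turn b i x
  adj⇒turn (_ , inj₁ p) = true  , p
  adj⇒turn (_ , inj₂ p) = false , p

  module _ {n : ℕ} {S : Subgraph n} where

    private
      to : S ≅ cycle N → Fin N → Fin n
      to = _≅_.to

    reparametrise : (φ : S ≅ cycle N) (σ : Fin N → Fin N) → (∀ {i j} → σ i ≡ σ j → i ≡ j) →
                    (∀ i → ∃[ j ] σ j ≡ i) → (∀ i j → Adjᶜ i j ⇔ Adjᶜ (σ i) (σ j)) → S ≅ cycle N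
    reparametrise φ σ σ-inj σ-surj σ-adj = record
      { to        = to φ ∘ σ
      ; injective = λ e → σ-inj (_≅_.injective φ e)
      ; image     = λ v → mk⇔
          (λ v∈ → case Equivalence.to (_≅_.image φ v) v∈ of λ { (i , p) →
                    case σ-surj i of λ { (j , q) → j , trans (cong (to φ) q) p } })
          (λ (i , p) → Equivalence.from (_≅_.image φ v) (σ i , p))
      ; adjacency = λ i j → mk⇔
          (λ a → Equivalence.to (_≅_.adjacency φ (σ i) (σ j)) (Equivalence.to (σ-adj i j) a))
          (λ e → Equivalence.from (σ-adj i j) (Equivalence.from (_≅_.adjacency φ (σ i) (σ j)) e))
      }

    rotate : S ≅ cycle N → S ≅ cycle N
    rotate φ = reparametrise φ σ σ-inj surj adj
      where
      σ : Fin N → Fin N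
      σ i = proj₁ (next i)
      σ-inj : ∀ {i j} → σ i ≡ σ j → i ≡ j
      σ-inj {i} {j} e = next-injective (proj₂ (next i)) (subst (Next j) (sym e) (proj₂ (next j)))
      surj : ∀ i → ∃[ j ] σ j ≡ i
      surj i = let j , j→i = previous i in j , next-functional (proj₂ (next j)) j→i
      next⁺ : ∀ {i j} → Next i j → Next (σ i) (σ j)
      next⁺ {i} {j} i→j rewrite next-functional i→j (proj₂ (next i)) = proj₂ (next (σ i))
      next⁻ : ∀ {i j} → Next (σ i) (σ j) → Next i j
      next⁻ {i} {j} p = subst (Next i) (next-injective p (proj₂ (next j))) (proj₂ (next i))
      adj : ∀ i j → Adjᶜ i j ⇔ Adjᶜ (σ i) (σ j)
      adj i j = mk⇔
        (λ { (_ , inj₁ p) → next⇒adj (next⁺ p) ; (_ , inj₂ p) → next⇒adj′ (next⁺ p) })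
        (λ { (_ , inj₁ p) → next⇒adj (next⁻ p) ; (_ , inj₂ p) → next⇒adj′ (next⁻ p) })

    reflect : S ≅ cycle N → S ≅ cycle N
    reflect φ = reparametrise φ opposite inj (λ i → opposite i , opposite-involutive i) adj
      where
      inj : ∀ {i j : Fin N} → opposite i ≡ opposite j → i ≡ j
      inj {i} {j} e = trans (sym (opposite-involutive i)) (trans (cong opposite e) (opposite-involutive j))
      next⁻ : ∀ {i j} → Next (opposite i) (opposite j) → Next j i
      next⁻ {i} {j} p = subst₂ Next (opposite-involutive j) (opposite-involutive i) (next-opposite p)
      adj : ∀ i j → Adjᶜ i j ⇔ Adjᶜ (opposite i) (opposite j)
      adj i j = mk⇔
        (λ { (_ , inj₁ p) → next⇒adj′ (next-opposite p) ; (_ , inj₂ p) → next⇒adj (next-opposite p) })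
        (λ { (_ , inj₁ p) → next⇒adj′ (next⁻ p) ; (_ , inj₂ p) → next⇒adj (next⁻ p) })

    -- Each rotation brings `i` one place nearer to the front. The image of the second vertex is
    -- tracked too, because the first two images fix the whole labelling.
    rotateTo : ∀ k i → toℕ i ≡ k → (φ : S ≅ cycle N) →
               ∃[ ψ ] to ψ 1st ≡ to φ i × ∃[ x ] (Next i x × to ψ 2nd ≡ to φ x)
    rotateTo zero    fzero    _  φ = φ , refl , 2nd , inj₁ refl , refl
    rotateTo (suc k) (fsuc i) eq φ with previous (fsuc i)
    ... | i′ , i′→i@(inj₁ p) with rotateTo k i′ (suc-injective (trans (sym p) eq)) (rotate φ)
    ...   | ψ , ψ0 , x , i′→x , ψ1 rewrite next-functional i′→x i′→i =
      ψ , trans ψ0 (cong (to φ) (next-functional (proj₂ (next i′)) i′→i)) , _ , proj₂ (next (fsuc i)) , ψ1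

    -- The dihedral group acts transitively on pairs of a start and a direction; a backward
    -- traversal is a forward traversal of the reflected labelling.
    turn : (b : Bool) (i : Fin N) (φ : S ≅ cycle N) →
           ∃[ ψ ] to ψ 1st ≡ to φ i × ∃[ x ] (Turn b i x × to ψ 2nd ≡ to φ x)
    turn true  i φ = rotateTo _ i refl φ
    turn false i φ with rotateTo _ (opposite i) refl (reflect φ)
    ... | ψ , ψ0 , x , i→x , ψ1 = ψ , trans ψ0 (cong (to φ) (opposite-involutive i)) , opposite x
        , subst (Next (opposite x)) (opposite-involutive i) (next-opposite i→x) , ψ1

    -- In a cycle the next vertex is one of the two neighbours of the present one, and the other
    -- neighbour is the vertex just left, which injectivity excludes.
    turn-determines : {G : Graph n} → S IsSubgraphOf G → (φ ψ : S ≅ cycle N) →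
                      to φ 1st ≡ to ψ 1st → to φ 2nd ≡ to ψ 2nd → ∀ i → to φ i ≡ to ψ i
    turn-determines S⊆G φ ψ eq₁ eq₂ fzero    = eq₁
    turn-determines S⊆G φ ψ eq₁ eq₂ (fsuc i) = proj₂ (go (toℕ i) (proj₁ (previous (fsuc i))) (fsuc i) (before (proj₂ (previous (fsuc i)))) refl)
      where
      before : ∀ {h : Fin N} {i} → Next h (fsuc i) → toℕ h ≡ toℕ i
      before (inj₁ p) = suc-injective (sym p)
      -- Agreement is carried for two consecutive vertices, since excluding a step back needs the
      -- earlier one.
      go : ∀ k i j → toℕ i ≡ k → toℕ j ≡ suc k → to φ i ≡ to ψ i × to φ j ≡ to ψ j
      go zero    fzero    (fsuc fzero) _ _ = eq₁ , eq₂
      go (suc k) i@(fsuc i₀) j p q with previous i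
      ... | h , h→i@(inj₁ r) with go k h i (suc-injective (trans (sym r) p)) p
      ...   | eqₕ , eqᵢ = eqᵢ , eqⱼ
        where
        open _IsSubgraphOf_ S⊆G
        i→j : Next i j
        i→j = inj₁ (trans q (cong suc (sym p)))
        e : Subgraph.Edge S (to ψ i) (to φ j)
        e = subst (λ v → Subgraph.Edge S v (to φ j)) eqᵢ (Equivalence.to (_≅_.adjacency φ i j) (next⇒adj i→j))
        eqⱼ : to φ j ≡ to ψ j
        eqⱼ with Equivalence.to (_≅_.image ψ (to φ j)) (endpoint _ _ (edgeSymmetric _ _ e))
        ... | x , ψx≡ with Equivalence.from (_≅_.adjacency ψ i x) (subst (Subgraph.Edge S (to ψ i)) (sym ψx≡) e)
        ...   | _ , inj₁ i→x = trans (sym ψx≡) (cong (to ψ) (next-functional i→x i→j))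
        ...   | _ , inj₂ x→i = contradiction (trans q (cong suc (sym p))) (j≢1+i (_≅_.injective φ (begin
            to φ j ≡⟨ ψx≡ ⟨
            to ψ x ≡⟨ cong (to ψ) (next-injective x→i h→i) ⟩
            to ψ h ≡⟨ eqₕ ⟨
            to φ h ∎)))
          where
          open ≡-Reasoning
          j≢1+i : j ≡ h → toℕ j ≢ suc (toℕ i)
          j≢1+i refl s = <⇒≢ (n≤1+n _) (trans s (cong suc r))

-- Double counting of cycles and labelled cycles

length-cartesianProduct : (xs : List A) (ys : List B) → length (cartesianProduct xs ys) ≡ length xs * length ys
length-cartesianProduct []       ys = refl
length-cartesianProduct (x ∷ xs) ys = trans (length-++ (map (x ,_) ys))
  (cong₂ _+_ (length-map (x ,_) ys) (length-cartesianProduct xs ys))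

tabulate⇒linked : {R : Rel A 0ℓ} (f : Fin m → A) →
                  (∀ i j → toℕ j ≡ suc (toℕ i) → R (f i) (f j)) → Linked R (tabulate f)
tabulate⇒linked {m = zero}        f r = []
tabulate⇒linked {m = suc zero}    f r = [-]
tabulate⇒linked {m = suc (suc m)} f r =
  r fzero (fsuc fzero) refl ∷ tabulate⇒linked (f ∘ fsuc) λ i j p → r (fsuc i) (fsuc j) (cong suc p)

module CountCycles (m : ℕ) {n : ℕ} (G : Graph n) where

  open Cyclic m
  private
    to : {S : Subgraph n} → S ≅ cycle N → Fin N → Fin n
    to = _≅_.to

  -- A copy with a start and a direction. Every copy has `N * 2` of these, which is 4l when `N` is
  -- 2l.
  Turns : Set
  Turns = Subgraph n × Fin N × Bool

  turns : List Turns
  turns = cartesianProduct (copyList (cycle N) G) (cartesianProduct (allFin N) (true ∷ false ∷ []))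

  length-turns : length turns ≡ copyCount (cycle N) G * (N * 2)
  length-turns = trans (length-cartesianProduct (copyList (cycle N) G) (cartesianProduct (allFin N) (true ∷ false ∷ [])))
    (cong₂ _*_ (length-copyList (cycle N) G) (trans (length-cartesianProduct (allFin N) (true ∷ false ∷ []))
      (cong (_* 2) (length-tabulate {n = N} id))))

  turns-unique : Unique turns
  turns-unique = Unique.cartesianProduct⁺ (copyList-unique (cycle N) G)
    (Unique.cartesianProduct⁺ (Unique.allFin⁺ N) (((λ ()) ∷ []) ∷ [] ∷ []))

  ∈-turns : {S : Subgraph n} → S ∈ˡ copyList (cycle N) G → ∀ i b → (S , i , b) ∈ˡ turns
  ∈-turns S∈ i b = ∈-cartesianProduct⁺ S∈ (∈-cartesianProduct⁺ (∈-allFin i) (∈-bool b))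
    where
    ∈-bool : ∀ b → b ∈ˡ true ∷ false ∷ []
    ∈-bool true  = here refl
    ∈-bool false = there (here refl)

  -- The closed walk v runs once around the cycle S, starting at the i-th vertex
  -- of the reference labelling of S in the direction b.
  record Traverses (v : Vec (Fin n) N) (t : Turns) : Set where
    field
      ⊆G        : proj₁ t IsSubgraphOf G
      φ ψ       : proj₁ t ≅ cycle N
      reference : decide≅ (proj₁ t) (cycle N) ≡ yes φ
      along     : ∀ i → lookup v i ≡ to ψ i
      start     : to ψ 1st ≡ to φ (proj₁ (proj₂ t))
      turnsAt   : ∃[ x ] (Turn (proj₂ (proj₂ t)) (proj₁ (proj₂ t)) x × to ψ 2nd ≡ to φ x)

  yes-injective : {P : Set} {p q : P} → yes p ≡ yes q → p ≡ q
  yes-injective refl = refl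

  reference-exists : {S : Subgraph n} → S ≅ cycle N → ∃[ φ ] decide≅ S (cycle N) ≡ yes φ
  reference-exists {S} φ with decide≅ S (cycle N)
  ... | yes φ′ = φ′ , refl
  ... | no ¬φ  = contradiction φ ¬φ

  -- The vector fixes `ψ` and so the subgraph. The field `reference` ties `φ` to the outcome of
  -- `decide≅`, so both traversals share one `φ`; in it, the images of the first two vertices reveal
  -- start and direction.
  traverses-functional : ∀ {t t′ v} → Traverses v t → Traverses v t′ → t ≡ t′
  traverses-functional {S , i , b} {S′ , i′ , b′} r r′
    with ≅-determines r.⊆G r′.⊆G r.ψ r′.ψ (λ k → trans (sym (r.along k)) (r′.along k))
    where
    module r = Traverses r
    module r′ = Traverses r′
  ... | refl with yes-injective (trans (sym (Traverses.reference r)) (Traverses.reference r′))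
  ...   | refl = same (_≅_.injective r.φ (trans (sym r.start) (trans (same-ψ 1st) r′.start))) r.turnsAt r′.turnsAt
    where
    module r = Traverses r
    module r′ = Traverses r′
    same-ψ : ∀ k → to r.ψ k ≡ to r′.ψ k
    same-ψ k = trans (sym (r.along k)) (r′.along k)
    same : i ≡ i′ → ∃[ x ] (Turn b i x × to r.ψ 2nd ≡ to r.φ x) →
           ∃[ x ] (Turn b′ i′ x × to r′.ψ 2nd ≡ to r.φ x) → (S , i , b) ≡ (S , i′ , b′)
    same refl (x , p , e) (x′ , p′ , e′) with _≅_.injective r.φ (trans (sym e) (trans (same-ψ 2nd) e′))
    ... | refl = cong (λ c → S , i , c) (turn-unique b b′ p p′)

  -- Read in the common `φ`, start and direction give the first two values of `ψ`, and
  -- `turn-determines` gives the rest.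
  traverses-injective : ∀ {v v′ t} → Traverses v t → Traverses v′ t → v ≡ v′
  traverses-injective {v} {v′} {S , i , b} r r′
    with yes-injective (trans (sym (Traverses.reference r)) (Traverses.reference r′))
  ... | refl = same (Traverses.turnsAt r) (Traverses.turnsAt r′)
    where
    module r = Traverses r
    module r′ = Traverses r′
    same : ∃[ x ] (Turn b i x × to r.ψ 2nd ≡ to r.φ x) → ∃[ x ] (Turn b i x × to r′.ψ 2nd ≡ to r.φ x) → v ≡ v′
    same (x , p , e) (x′ , p′ , e′) = lookup-extensional v v′ λ k → trans (r.along k) (trans
      (turn-determines r.⊆G r.ψ r′.ψ (trans r.start (sym r′.start))
        (trans e (trans (cong (to r.φ) (turn-functional b p p′)) (sym e′))) k)
      (sym (r′.along k)))

  copies≤walks : copyCount (cycle N) G * (N * 2) ≤ length (walks (Graph.adj? G) (Graph.symmetric G) N)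
  copies≤walks = subst (_≤ length (walks (Graph.adj? G) (Graph.symmetric G) N)) length-turns
    (length-≤-via turns-unique walkOf traverses-functional)
    where
    walkOf : ∀ {t} → t ∈ˡ turns → ∃[ v ] v ∈ˡ walks (Graph.adj? G) (Graph.symmetric G) N × Traverses v t
    walkOf {S , i , b} t∈ with ∈-cartesianProduct⁻ (copyList (cycle N) G) (cartesianProduct (allFin N) (true ∷ false ∷ [])) t∈
    ... | S∈ , _ with ∈-copyList⁻ (cycle N) S∈
    ...   | S⊆G , φ₀ with reference-exists φ₀
    ...     | φ , ref with turn b i φ
    ...       | ψ , ψ0 , ψ1 = tabulate (to ψ)
      , ∈-filter⁺ (linked? (Graph.adj? G)) (∈-allVecs ∈-allFin (tabulate (to ψ)))
          (tabulate⇒linked (to ψ) λ i j p →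
            edges⊆ _ _ (Equivalence.to (_≅_.adjacency ψ i j) (next⇒adj (inj₁ p))))
      , record { ⊆G = S⊆G ; φ = φ ; ψ = ψ ; reference = ref ; along = lookup∘tabulate (to ψ)
               ; start = ψ0 ; turnsAt = ψ1 }
      where open _IsSubgraphOf_ S⊆G

  embeddings≤copies : {vs : List (Vec (Fin n) N)} → Unique vs →
                      (∀ {v} → v ∈ˡ vs → cycle N ↪ G via lookup v) →
                      length vs ≤ copyCount (cycle N) G * (N * 2)
  embeddings≤copies {vs} vs! vs↪ = subst (length vs ≤_) length-turns
    (length-≤-via vs! turnOf traverses-injective)
    where
    turnOf : ∀ {v} → v ∈ˡ vs → ∃[ t ] t ∈ˡ turns × Traverses v t
    turnOf {v} v∈ = locate (reference-exists ψ)
      where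
      S : Subgraph n
      S = image (cycle N) (lookup v)
      S⊆G : S IsSubgraphOf G
      S⊆G = image-⊆ (cycle N) (lookup v) {G} (vs↪ v∈)
      ψ : S ≅ cycle N
      ψ = image-≅ (cycle N) (lookup v) (proj₁ (vs↪ v∈))
      adj : ∀ φ {i x} → to φ i ≡ to ψ 1st → to φ x ≡ to ψ 2nd → Graph.Adj (cycle N) i x
      adj φ {i} {x} p q = Equivalence.from (_≅_.adjacency φ i x)
        (subst₂ (Subgraph.Edge S) (sym p) (sym q) (Equivalence.to (_≅_.adjacency ψ 1st 2nd) (next⇒adj (inj₁ refl))))
      vertexOf : ∀ φ i → ∃[ j ] to φ j ≡ to ψ i
      vertexOf φ i = Equivalence.to (_≅_.image φ (to ψ i)) (Equivalence.from (_≅_.image ψ (to ψ i)) (i , refl))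
      -- The start is the `φ`-position of the first entry of `v`. The second entry is adjacent to it
      -- in `S`, so its position is one turn away, and the side on which it lies is the direction.
      locate : ∃[ φ ] decide≅ S (cycle N) ≡ yes φ → ∃[ t ] t ∈ˡ turns × Traverses v t
      locate (φ , ref) = (S , i , b) , ∈-turns (∈-copyList⁺ (cycle N) S⊆G ψ) i b , record
        { ⊆G = S⊆G ; φ = φ ; ψ = ψ ; reference = ref ; along = λ _ → refl
        ; start = sym (proj₂ i,p) ; turnsAt = proj₁ x,q , proj₂ b,turn , sym (proj₂ x,q) }
        where
        i,p = vertexOf φ 1st
        x,q = vertexOf φ 2nd
        i = proj₁ i,p
        b,turn = adj⇒turn {i} {proj₁ x,q} (adj φ (proj₂ i,p) (proj₂ x,q))
        b = proj₁ b,turn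

-- Odd-cycle-free graphs: upper bound on the number of copies

linked-lookup : {R : Rel A 0ℓ} {v : Vec A m} → Linked R v →
                ∀ i j → toℕ j ≡ suc (toℕ i) → R (lookup v i) (lookup v j)
linked-lookup {v = _ ∷ _ ∷ _} (r ∷ _)  fzero    (fsuc fzero) _  = r
linked-lookup {v = _ ∷ _ ∷ _} (_ ∷ rs) (fsuc i) (fsuc j)     eq = linked-lookup rs i j (suc-injective eq)

linked⇒cycle : (G : Graph n) {v : Vec (Fin n) (suc m)} → Linked (Graph.Adj G) v → Distinct v →
               (∀ i → toℕ i ≡ m → Graph.Adj G (lookup v i) (lookup v fzero)) →
               cycle (suc m) ↪ G via lookup v
linked⇒cycle {m = m} G {v} v-linked v! closing = v! , hom
  where
  step : ∀ {i j} → Next i j → Graph.Adj G (lookup v i) (lookup v j)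
  step {i} {j}     (inj₁ p)        = linked-lookup v-linked i j p
  step {i} {fzero} (inj₂ (p , _)) = closing i (suc-injective p)
  hom : ∀ i j → Graph.Adj (cycle (suc m)) i j → Graph.Adj G (lookup v i) (lookup v j)
  hom i j (_ , inj₁ i→j) = step i→j
  hom i j (_ , inj₂ j→i) = Graph.symmetric G (step j→i)

module OddCycleFree {n : ℕ} (G : Graph n) (L : ℕ) (free : Free (cycle (suc (suc L))) G) where

  open Graph G using (Adj; adj?; symmetric; loopless)

  link-pathless : ∀ v → ¬ PathIn adj? symmetric (neighbours adj? symmetric v) (suc L)
  link-pathless v (p@(_ ∷ _) , p-linked , p! , p⊆) = free
    ( image (cycle (suc (suc L))) (lookup (v ∷ p))
    , image-⊆ (cycle (suc (suc L))) (lookup (v ∷ p)) {G} embedding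
    , image-≅ (cycle (suc (suc L))) (lookup (v ∷ p)) (proj₁ embedding) )
    where
    adj : ∀ i → Adj v (lookup p i)
    adj i = proj₂ (∈-filter⁻ (adj? v) {xs = allFin n} (p⊆ i))
    embedding : cycle (suc (suc L)) ↪ G via lookup (v ∷ p)
    embedding = linked⇒cycle G (adj fzero ∷ p-linked)
      (distinct-∷ (λ i e → loopless (subst (Adj v) e (adj i))) p!)
      λ { (fsuc i) _ → symmetric (adj i) }

  linkArcs≤ : ∀ v → linkArcs adj? symmetric v ≤ 2 * suc L * n
  linkArcs≤ v = begin
    linkArcs adj? symmetric v ≤⟨ pathless⇒sparse adj? symmetric (suc L) (s≤s z≤n) (Unique.filter⁺ (adj? v) (Unique.allFin⁺ n)) (link-pathless v) ⟩
    length (neighbours adj? symmetric v) * (2 * suc L) ≤⟨ *-monoˡ-≤ (2 * suc L) (length-filter (adj? v) (allFin n)) ⟩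
    length (allFin n) * (2 * suc L) ≡⟨ cong (_* (2 * suc L)) (length-tabulate {n = n} id) ⟩
    n * (2 * suc L)           ≡⟨ *-comm n (2 * suc L) ⟩
    2 * suc L * n             ∎
    where open ≤-Reasoning

  -- The even length appears in two shapes: `3 + m` for the cyclic structure, which needs three
  -- vertices, and `suc j * 2` for grouping steps into pairs.
  copyCount≤ : ∀ m j → 3 + m ≡ suc j * 2 →
               4 ^ suc j * (copyCount (cycle (3 + m)) G * ((3 + m) * 2))
               ≤ 2 * (n * n + 4 * (2 * suc L * n)) ^ suc j
  copyCount≤ m j eq = ≤-trans
    (*-monoʳ-≤ (4 ^ suc j) (CountCycles.copies≤walks m G))
    (subst (λ N → 4 ^ suc j * length (walks adj? symmetric N) ≤ 2 * (n * n + 4 * (2 * suc L * n)) ^ suc j)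
      (sym eq) (4^j*walks≤ adj? symmetric (2 * suc L) linkArcs≤ j))

-- The balanced complete bipartite graph

alternate : ℕ → Bool → Bool
alternate zero    c = c
alternate (suc k) c = not (alternate k c)

alternate-not : ∀ k c → alternate k (not c) ≡ not (alternate k c)
alternate-not zero    c = refl
alternate-not (suc k) c = cong not (alternate-not k c)

alternate-even : ∀ j c → alternate (j * 2) c ≡ c
alternate-even zero    c = refl
alternate-even (suc j) c = trans (not-involutive _) (alternate-even j c)

alternating : (c : Fin (suc m) → Bool) → (∀ i j → toℕ j ≡ suc (toℕ i) → c i ≢ c j) →
              ∀ i → c i ≡ alternate (toℕ i) (c fzero)
alternating             c c≢ fzero    = refl
alternating {m = suc m} c c≢ (fsuc i) = begin
  c (fsuc i)                            ≡⟨ alternating (c ∘ fsuc) (λ i j p → c≢ (fsuc i) (fsuc j) (cong suc p)) i ⟩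
  alternate (toℕ i) (c (fsuc fzero))    ≡⟨ cong (alternate (toℕ i)) (¬-not (c≢ fzero (fsuc fzero) refl ∘ sym)) ⟩
  alternate (toℕ i) (not (c fzero))     ≡⟨ alternate-not (toℕ i) (c fzero) ⟩
  not (alternate (toℕ i) (c fzero))     ∎
  where open ≡-Reasoning

colour : Fin n → Bool
colour x = alternate (toℕ x) true

bipartite : ∀ n → Graph n
bipartite n = record
  { Adj       = λ x y → colour x ≢ colour y
  ; adj?      = λ x y → ¬? (colour x ≟ᵇ colour y)
  ; symmetric = λ x≢y → x≢y ∘ sym
  ; loopless  = λ x≢x → x≢x refl
  }

-- Colours alternate around the cycle. Its last vertex has even index, hence the colour of the first
-- vertex, to which it is adjacent.
bipartite-free : ∀ n k → Free (cycle (suc (suc k * 2))) (bipartite n)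
bipartite-free n k (S , S⊆G , φ) = differ last fzero (λ e → case trans (sym last≡) (cong toℕ e) of λ ())
  (inj₂ (cong suc last≡ , refl))
  (trans (alternating (colour ∘ to) (λ i j p → differ i j (λ e → <⇒≢ (n<1+n _) (trans (cong toℕ e) p)) (inj₁ p)) last)
    (trans (cong (λ t → alternate t (colour (to fzero))) last≡) (alternate-even (suc k) _)))
  where
  open _≅_ φ
  open _IsSubgraphOf_ S⊆G
  last : Fin (suc (suc k * 2))
  last = fromℕ (suc k * 2)
  last≡ : toℕ last ≡ suc k * 2
  last≡ = toℕ-fromℕ (suc k * 2)
  differ : ∀ i j → i ≢ j → Next i j → colour (to i) ≢ colour (to j)
  differ i j i≢j i→j = edges⊆ _ _ (Equivalence.to (adjacency i j) (i≢j , inj₁ i→j))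

colourClass : Bool → ℕ → ℕ
colourClass b n = Σ[ allFin n ] (λ x → ind (colour x ≟ᵇ b))

colourClass-suc : ∀ b n → colourClass b (suc n) ≡ ind (true ≟ᵇ b) + colourClass (not b) n
colourClass-suc b n = cong (λ t → ind (true ≟ᵇ b) + t) (begin
  Σ[ Data.List.Base.tabulate fsuc ] inClass ≡⟨ cong (λ xs → Σ[ xs ] inClass) (map-tabulate id fsuc) ⟨
  Σ[ map fsuc (allFin n) ] inClass          ≡⟨ Σ-map fsuc (allFin n) inClass ⟩
  Σ[ allFin n ] (inClass ∘ fsuc)            ≡⟨ Σ-cong (allFin n) (λ x → flip (colour x) b) ⟩
  colourClass (not b) n                     ∎)
  where
  open ≡-Reasoning
  inClass : Fin (suc n) → ℕ
  inClass x = ind (colour x ≟ᵇ b)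
  flip : ∀ c b → ind (not c ≟ᵇ b) ≡ ind (c ≟ᵇ not b)
  flip true  true  = refl
  flip true  false = refl
  flip false true  = refl
  flip false false = refl

-- Colours are parities, and a new vertex at the front exchanges the classes; two new vertices
-- therefore add one to each class.
n≤1+2*colourClass : ∀ b n → n ≤ 1 + 2 * colourClass b n
n≤1+2*colourClass b zero          = z≤n
n≤1+2*colourClass b (suc zero)    = s≤s z≤n
n≤1+2*colourClass b (suc (suc n)) = begin
  2 + n                               ≤⟨ +-monoʳ-≤ 2 (n≤1+2*colourClass b n) ⟩
  2 + (1 + 2 * colourClass b n)       ≡⟨ arith (colourClass b n) ⟩
  1 + 2 * suc (colourClass b n)       ≡⟨ cong (λ t → 1 + 2 * t) (two b) ⟨
  1 + 2 * colourClass b (suc (suc n)) ∎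
  where
  open ≤-Reasoning
  arith : ∀ c → 2 + (1 + 2 * c) ≡ 1 + 2 * suc c
  arith = solve-∀
  two : ∀ b → colourClass b (suc (suc n)) ≡ suc (colourClass b n)
  two true  = trans (colourClass-suc true (suc n)) (cong suc (colourClass-suc false n))
  two false = trans (colourClass-suc false (suc n)) (colourClass-suc true n)

-- Greedy paths: lower bound on the number of copies

module GreedyPaths (n : ℕ) where

  open Graph (bipartite n) using (Adj; adj?)

  Extends : Fin n → Vec (Fin n) (suc m) → Set
  Extends x v = Adj x (head v) × ¬ (x ∈ˡ toList v)

  extends? : (x : Fin n) (v : Vec (Fin n) (suc m)) → Dec (Extends x v)
  extends? x v = adj? x (head v) ×-dec ¬? (∈-dec _≟ᶠ_ x (toList v))

  -- The paths of the bipartite graph, built by prepending. In this form the indicator of a longer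
  -- path is a product, so summing over the new head counts its choices.
  Good : Vec (Fin n) m → Set
  Good []          = ⊤
  Good (x ∷ [])    = ⊤
  Good (x ∷ y ∷ v) = Extends x (y ∷ v) × Good (y ∷ v)

  good? : (v : Vec (Fin n) m) → Dec (Good v)
  good? []          = yes tt
  good? (x ∷ [])    = yes tt
  good? (x ∷ y ∷ v) = extends? x (y ∷ v) ×-dec good? (y ∷ v)

  good⇒linked : (v : Vec (Fin n) m) → Good v → Linked Adj v
  good⇒linked []          _             = []
  good⇒linked (x ∷ [])    _             = [-]
  good⇒linked (x ∷ y ∷ v) ((a , _) , g) = a ∷ good⇒linked (y ∷ v) g

  good⇒distinct : (v : Vec (Fin n) m) → Good v → Distinct v
  good⇒distinct []          _              = λ ()
  good⇒distinct (x ∷ [])    _              = λ { fzero fzero _ → refl }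
  good⇒distinct (x ∷ y ∷ v) ((_ , x∉) , g) = distinct-∷
    (λ { i refl → x∉ (∈-toList⁺ (∈-lookup i (y ∷ v))) }) (good⇒distinct (y ∷ v) g)

  ind-split : {P Q T : Set} (P? : Dec P) (Q? : Dec Q) (T? : Dec T) → (T → P) →
              ind T? ≤ ind (P? ×-dec ¬? Q?) + ind Q?
  ind-split _        _       (no _)  _   = z≤n
  ind-split (no ¬p)  _       (yes t) t⇒p = contradiction (t⇒p t) ¬p
  ind-split (yes _)  (yes _) (yes _) _   = s≤s z≤n
  ind-split (yes _)  (no _)  (yes _) _   = s≤s z≤n

  extensions≥ : (v : Vec (Fin n) (suc m)) →
                n ≤ 1 + 2 * (Σ[ allFin n ] (λ x → ind (extends? x v)) + suc m)
  extensions≥ {m} v = begin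
    n                                              ≤⟨ n≤1+2*colourClass (not (colour (head v))) n ⟩
    1 + 2 * colourClass (not (colour (head v))) n  ≤⟨ s≤s (*-monoʳ-≤ 2 (Σ-mono (allFin n) pointwise)) ⟩
    1 + 2 * Σ[ allFin n ] (λ x → ind (extends? x v) + ind (used? x)) ≡⟨ cong (λ t → 1 + 2 * t) (Σ-+ (allFin n) _ _) ⟩
    1 + 2 * (Σ[ allFin n ] (λ x → ind (extends? x v)) + Σ[ allFin n ] (ind ∘ used?))
      ≤⟨ s≤s (*-monoʳ-≤ 2 (+-monoʳ-≤ (Σ[ allFin n ] (λ x → ind (extends? x v))) used≤)) ⟩
    1 + 2 * (Σ[ allFin n ] (λ x → ind (extends? x v)) + suc m) ∎
    where
    open ≤-Reasoning
    used? : U.Decidable (_∈ˡ toList v)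
    used? x = ∈-dec _≟ᶠ_ x (toList v)
    pointwise : ∀ x → ind (colour x ≟ᵇ not (colour (head v))) ≤ ind (extends? x v) + ind (used? x)
    pointwise x = ind-split (adj? x (head v)) (used? x) (colour x ≟ᵇ not (colour (head v)))
                    λ p q → not-¬ refl (trans (sym q) p)
    used≤ : Σ[ allFin n ] (ind ∘ used?) ≤ suc m
    used≤ = begin
      Σ[ allFin n ] (ind ∘ used?)         ≡⟨ length-filter≡Σ used? (allFin n) ⟨
      length (filter used? (allFin n))    ≤⟨ unique⊆⇒length≤ (Unique.filter⁺ used? (Unique.allFin⁺ n)) (λ x∈ → proj₂ (∈-filter⁻ used? {xs = allFin n} x∈)) ⟩
      length (toList v)                   ≡⟨ length-toList v ⟩
      suc m                               ∎

  goodPaths : ∀ m → List (Vec (Fin n) m)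
  goodPaths m = filter good? (allVecs (allFin n) m)

  Σ-good-∷ : (v : Vec (Fin n) (suc m)) →
             Σ[ allFin n ] (λ x → ind (good? (x ∷ v))) ≡ Σ[ allFin n ] (λ x → ind (extends? x v)) * ind (good? v)
  Σ-good-∷ v@(y ∷ w) = trans (Σ-cong (allFin n) λ x → ind-× (extends? x v) (good? v))
                             (Σ-*ʳ (allFin n) (ind (good? v)) _)

  -- Extending a path on i vertices has at least (n - 1 - 2i)/2 choices. As `q` dominates 1 + 2i for
  -- all i up to `m`, every extension shares the base `n ∸ q`, and `2 ^ m` clears the halves.
  goodPaths≥ : ∀ q m → 1 + 2 * m ≤ q → n * (n ∸ q) ^ m ≤ 2 ^ m * length (goodPaths (suc m))
  goodPaths≥ q zero    _ = ≤-reflexive (begin-equality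
    n * 1                                 ≡⟨ cong (_* 1) (length-tabulate {n = n} id) ⟨
    length (allFin n) * 1                 ≡⟨ Σ-const (allFin n) 1 ⟨
    Σ[ allFin n ] (λ _ → 1)               ≡⟨ Σ-allVecs (allFin n) 0 (ind ∘ good?) ⟨
    Σ[ allVecs (allFin n) 1 ] (ind ∘ good?) ≡⟨ length-filter≡Σ good? (allVecs (allFin n) 1) ⟨
    length (goodPaths 1)                  ≡⟨ +-identityʳ _ ⟨
    length (goodPaths 1) + 0              ∎)
    where open ≤-Reasoning
  goodPaths≥ q (suc m) 1+2m≤q = begin
    n * (D * D ^ m)                       ≡⟨ arith₁ n D (D ^ m) ⟩
    D * (n * D ^ m)                       ≤⟨ *-monoʳ-≤ D (goodPaths≥ q m (≤-trans (s≤s (*-monoʳ-≤ 2 (n≤1+n m))) 1+2m≤q)) ⟩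
    D * (2 ^ m * length (goodPaths (suc m))) ≡⟨ arith₂ D (2 ^ m) _ ⟩
    2 ^ m * (D * length (goodPaths (suc m))) ≡⟨ cong (λ t → 2 ^ m * (D * t)) (length-filter≡Σ good? vs) ⟩
    2 ^ m * (D * Σ[ vs ] (ind ∘ good?))   ≡⟨ cong (2 ^ m *_) (Σ-*ˡ vs D _) ⟨
    2 ^ m * Σ[ vs ] (λ v → D * ind (good? v)) ≤⟨ *-monoʳ-≤ (2 ^ m) (Σ-mono vs λ v → *-monoˡ-≤ (ind (good? v)) (D≤ v)) ⟩
    2 ^ m * Σ[ vs ] (λ v → 2 * e v * ind (good? v)) ≡⟨ cong (2 ^ m *_) (Σ-cong vs λ v → trans (*-assoc 2 (e v) _) (cong (2 *_) (sym (Σ-good-∷ v)))) ⟩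
    2 ^ m * Σ[ vs ] (λ v → 2 * Σ[ allFin n ] (λ x → ind (good? (x ∷ v)))) ≡⟨ cong (2 ^ m *_) (Σ-*ˡ vs 2 _) ⟩
    2 ^ m * (2 * Σ[ vs ] (λ v → Σ[ allFin n ] (λ x → ind (good? (x ∷ v))))) ≡⟨ cong (λ t → 2 ^ m * (2 * t)) (Σ-swap vs (allFin n) _) ⟩
    2 ^ m * (2 * Σ[ allFin n ] (λ x → Σ[ vs ] (λ v → ind (good? (x ∷ v))))) ≡⟨ cong (λ t → 2 ^ m * (2 * t)) (Σ-allVecs (allFin n) (suc m) (ind ∘ good?)) ⟨
    2 ^ m * (2 * Σ[ allVecs (allFin n) (2 + m) ] (ind ∘ good?)) ≡⟨ cong (λ t → 2 ^ m * (2 * t)) (length-filter≡Σ good? (allVecs (allFin n) (2 + m))) ⟨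
    2 ^ m * (2 * length (goodPaths (2 + m))) ≡⟨ arith₃ (2 ^ m) _ ⟩
    2 ^ suc m * length (goodPaths (2 + m)) ∎
    where
    open ≤-Reasoning
    D = n ∸ q
    vs = allVecs (allFin n) (suc m)
    e : Vec (Fin n) (suc m) → ℕ
    e v = Σ[ allFin n ] (λ x → ind (extends? x v))
    arith₁ : ∀ n d p → n * (d * p) ≡ d * (n * p)
    arith₁ = solve-∀
    arith₂ : ∀ d p x → d * (p * x) ≡ p * (d * x)
    arith₂ = solve-∀
    arith₃ : ∀ p x → p * (2 * x) ≡ 2 * p * x
    arith₃ = solve-∀
    D≤ : ∀ v → D ≤ 2 * e v
    D≤ v = m≤n+o⇒m∸n≤o n q (begin
      n                           ≤⟨ extensions≥ v ⟩
      1 + 2 * (e v + suc m)       ≡⟨ arith₄ (e v) (suc m) ⟩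
      1 + 2 * suc m + 2 * e v     ≤⟨ +-monoˡ-≤ (2 * e v) 1+2m≤q ⟩
      q + 2 * e v                 ∎)
      where
      arith₄ : ∀ e m → 1 + 2 * (e + m) ≡ 1 + 2 * m + 2 * e
      arith₄ = solve-∀

  good⇒cycle : ∀ j (v : Vec (Fin n) (suc j * 2)) → Good v → cycle (suc j * 2) ↪ bipartite n via lookup v
  good⇒cycle j v v-good = linked⇒cycle (bipartite n) (good⇒linked v v-good) (good⇒distinct v v-good) closing
    where
    closing : ∀ i → toℕ i ≡ suc (j * 2) → colour (lookup v i) ≢ colour (lookup v fzero)
    closing i eq same = not-¬ refl (trans (sym same) (trans (alternating (colour ∘ lookup v)
      (λ i j → linked-lookup (good⇒linked v v-good) i j) i)
      (trans (cong (λ t → alternate t (colour (lookup v fzero))) eq) (cong not (alternate-even j _)))))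

  copyCount≥ : ∀ m j → 3 + m ≡ suc j * 2 →
               n * (n ∸ (1 + 2 * (2 + m))) ^ (2 + m) ≤ 2 ^ (2 + m) * (copyCount (cycle (3 + m)) (bipartite n) * ((3 + m) * 2))
  copyCount≥ m j eq = ≤-trans (goodPaths≥ _ (2 + m) ≤-refl) (*-monoʳ-≤ (2 ^ (2 + m))
    (CountCycles.embeddings≤copies m (bipartite n)
      (Unique.filter⁺ good? (allVecs-unique (Unique.allFin⁺ n) (3 + m)))
      λ {v} v∈ → embedding _ eq v (proj₂ (∈-filter⁻ good? {xs = allVecs (allFin n) (3 + m)} v∈))))
    where
    -- The length becomes a variable so that the equation between its two shapes can be matched.
    embedding : ∀ N → N ≡ suc j * 2 → (v : Vec (Fin n) N) → Good v → cycle N ↪ bipartite n via lookup v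
    embedding N refl = good⇒cycle j

-- Error terms in ℕ

-- This is (1 + a/n)^l ≤ 1 + D/n with denominators cleared, where `D` depends on `a` and `l` only.
pow-upper : ∀ a l → ∃[ D ] (∀ n → 1 ≤ n → n * (n + a) ^ l ≤ (n + D) * n ^ l)
pow-upper a zero    = 0 , λ n _ → ≤-reflexive (cong (_* 1) (sym (+-identityʳ n)))
pow-upper a (suc l) with pow-upper a l
-- Expanding (n + a)(n + D) leaves the constant aD, which is at most aD·n because n ≥ 1; this
-- explains all three summands.
... | D , bound = a + D + a * D , λ n 1≤n → begin
  n * ((n + a) * (n + a) ^ l)                        ≡⟨ swap n (n + a) ((n + a) ^ l) ⟩
  (n + a) * (n * (n + a) ^ l)                        ≤⟨ *-monoʳ-≤ (n + a) (bound n 1≤n) ⟩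
  (n + a) * ((n + D) * n ^ l)                        ≡⟨ expand n a D (n ^ l) ⟩
  (n * n + (a + D) * n + a * D * 1) * n ^ l          ≤⟨ *-monoˡ-≤ (n ^ l) (+-monoʳ-≤ (n * n + (a + D) * n) (*-monoʳ-≤ (a * D) 1≤n)) ⟩
  (n * n + (a + D) * n + a * D * n) * n ^ l          ≡⟨ collect n a D (n ^ l) ⟩
  (n + (a + D + a * D)) * (n * n ^ l)                ∎
  where
  open ≤-Reasoning
  swap : ∀ x y z → x * (y * z) ≡ y * (x * z)
  swap = solve-∀
  expand : ∀ n a D p → (n + a) * ((n + D) * p) ≡ (n * n + (a + D) * n + a * D * 1) * p
  expand = solve-∀
  collect : ∀ n a D p → (n * n + (a + D) * n + a * D * n) * p ≡ (n + (a + D + a * D)) * (n * p)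
  collect = solve-∀

-- Bernoulli's inequality (1 - q/n)^m ≥ 1 - qm/n with denominators cleared. Truncation does no harm
-- for n < q, since n ≤ q + (n ∸ q) always holds.
pow-lower : ∀ q m → ∃[ D ] (∀ n → n * n ^ m ≤ n * (n ∸ q) ^ m + D * n ^ m)
pow-lower q zero    = 0 , λ n → ≤-reflexive (sym (+-identityʳ (n * 1)))
pow-lower q (suc m) with pow-lower q m
... | D , bound = q + D , λ n → begin
  n * (n * n ^ m)                                    ≤⟨ *-monoʳ-≤ n (bound n) ⟩
  n * (n * (n ∸ q) ^ m + D * n ^ m)                  ≡⟨ arith₁ n ((n ∸ q) ^ m) D (n ^ m) ⟩
  n * (n * (n ∸ q) ^ m) + D * (n * n ^ m)            ≤⟨ +-monoˡ-≤ _ (*-monoˡ-≤ (n * (n ∸ q) ^ m) (m≤n+m∸n n q)) ⟩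
  (q + (n ∸ q)) * (n * (n ∸ q) ^ m) + D * (n * n ^ m) ≡⟨ arith₂ n q (n ∸ q) ((n ∸ q) ^ m) (D * (n * n ^ m)) ⟩
  n * ((n ∸ q) * (n ∸ q) ^ m) + q * (n * (n ∸ q) ^ m) + D * (n * n ^ m)
    ≤⟨ +-monoˡ-≤ (D * (n * n ^ m)) (+-monoʳ-≤ (n * ((n ∸ q) * (n ∸ q) ^ m)) (*-monoʳ-≤ q (*-monoʳ-≤ n (^-monoˡ-≤ m (m∸n≤m n q))))) ⟩
  n * ((n ∸ q) * (n ∸ q) ^ m) + q * (n * n ^ m) + D * (n * n ^ m) ≡⟨ arith₃ _ q D (n * n ^ m) ⟩
  n * ((n ∸ q) * (n ∸ q) ^ m) + (q + D) * (n * n ^ m) ∎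
  where
  open ≤-Reasoning
  arith₁ : ∀ n x D y → n * (n * x + D * y) ≡ n * (n * x) + D * (n * y)
  arith₁ = solve-∀
  arith₂ : ∀ n q e x z → (q + e) * (n * x) + z ≡ n * (e * x) + q * (n * x) + z
  arith₂ = solve-∀
  arith₃ : ∀ z q D y → z + q * y + D * y ≡ z + (q + D) * y
  arith₃ = solve-∀

module Bounds (k m j : ℕ) (3+m≡ : 3 + m ≡ suc j * 2) where

  private
    p q a : ℕ
    p = 3 + m
    q = suc (suc k * 2)
    -- Here `k` is one less than in the theorem, so `suc k * 2` is the number of vertices of the
    -- forbidden path in a neighbourhood. With c twice this number, n² + 4cn equals n(n + `a`).
    a = 4 * (2 * (suc k * 2))

  -- Normalised so that the main term becomes `n ^ p`.
  scaled : ℕ → ℕ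
  scaled n = 4 ^ suc j * p * extremal n (cycle p) (cycle q)

  upper : ∃[ D ] (∀ n → 1 ≤ n → n * scaled n ≤ (n + D) * n ^ p)
  upper = D , λ n 1≤n → begin
    n * scaled n                               ≤⟨ *-monoʳ-≤ n (scaled≤ n) ⟩
    n * (n * (n + a)) ^ suc j                  ≡⟨ cong (n *_) (^-distribʳ-* (suc j) n (n + a)) ⟩
    n * (n ^ suc j * (n + a) ^ suc j)          ≡⟨ swap n (n ^ suc j) ((n + a) ^ suc j) ⟩
    n ^ suc j * (n * (n + a) ^ suc j)          ≤⟨ *-monoʳ-≤ (n ^ suc j) (proj₂ (pow-upper a (suc j)) n 1≤n) ⟩
    n ^ suc j * ((n + D) * n ^ suc j)          ≡⟨ square (n ^ suc j) (n + D) ⟩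
    (n + D) * (n ^ suc j) ^ 2                  ≡⟨ cong ((n + D) *_) (^-*-assoc n (suc j) 2) ⟩
    (n + D) * n ^ (suc j * 2)                  ≡⟨ cong (λ t → (n + D) * n ^ t) 3+m≡ ⟨
    (n + D) * n ^ p                            ∎
    where
    open ≤-Reasoning
    D = proj₁ (pow-upper a (suc j))
    swap : ∀ x y z → x * (y * z) ≡ y * (x * z)
    swap = solve-∀
    square : ∀ x y → x * (y * x) ≡ y * (x * (x * 1))
    square = solve-∀
    arith₁ : ∀ f p c → 2 * (f * p * c) ≡ f * (c * (p * 2))
    arith₁ = solve-∀
    arith₂ : ∀ n k → n * n + 4 * (2 * k * n) ≡ n * (n + 4 * (2 * k))
    arith₂ = solve-∀
    attained : ∀ n → (∃[ G ] Free (cycle q) G × copyCount (cycle p) G ≡ extremal n (cycle p) (cycle q)) →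
               2 * scaled n ≤ 2 * (n * (n + a)) ^ suc j
    attained n (G , free , count≡) = begin
      2 * scaled n ≡⟨ cong (λ c → 2 * (4 ^ suc j * p * c)) count≡ ⟨
      2 * (4 ^ suc j * p * copyCount (cycle p) G) ≡⟨ arith₁ (4 ^ suc j) p _ ⟩
      4 ^ suc j * (copyCount (cycle p) G * (p * 2)) ≤⟨ OddCycleFree.copyCount≤ G (suc (k * 2)) free m j 3+m≡ ⟩
      2 * (n * n + 4 * (2 * (suc k * 2) * n)) ^ suc j ≡⟨ cong (λ t → 2 * t ^ suc j) (arith₂ n (suc k * 2)) ⟩
      2 * (n * (n + a)) ^ suc j ∎
    scaled≤ : ∀ n → scaled n ≤ (n * (n + a)) ^ suc j
    scaled≤ n = *-cancelˡ-≤ 2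
      (attained n (extremal-attained (cycle p) (cycle q) (bipartite n , bipartite-free n k)))

  lower : ∃[ D ] (∀ n → n * n ^ p ≤ n * scaled n + D * n ^ p)
  lower = D , λ n → begin
    n * n ^ p                                  ≤⟨ *-monoʳ-≤ n (proj₂ (pow-lower (1 + 2 * (2 + m)) (2 + m)) n) ⟩
    n * (n * (n ∸ (1 + 2 * (2 + m))) ^ (2 + m) + D * n ^ (2 + m)) ≤⟨ *-monoʳ-≤ n (+-monoˡ-≤ (D * n ^ (2 + m)) (≤scaled n)) ⟩
    n * (scaled n + D * n ^ (2 + m))           ≡⟨ arith₂ n (scaled n) D (n ^ (2 + m)) ⟩
    n * scaled n + D * n ^ p                   ∎
    where
    open ≤-Reasoning
    D = proj₁ (pow-lower (1 + 2 * (2 + m)) (2 + m))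
    arith₁ : ∀ f p c → f * (c * (p * 2)) ≡ 2 * f * p * c
    arith₁ = solve-∀
    arith₂ : ∀ n s D x → n * (s + D * x) ≡ n * s + D * (n * x)
    arith₂ = solve-∀
    -- One halving for each of the `p` - 1 extensions, together with the factor two for directions,
    -- makes `2 ^ p`.
    2^p≡ : 2 ^ p ≡ 4 ^ suc j
    2^p≡ = trans (cong (2 ^_) (trans 3+m≡ (*-comm (suc j) 2))) (sym (^-*-assoc 2 2 (suc j)))
    ≤scaled : ∀ n → n * (n ∸ (1 + 2 * (2 + m))) ^ (2 + m) ≤ scaled n
    ≤scaled n = begin
      n * (n ∸ (1 + 2 * (2 + m))) ^ (2 + m)    ≤⟨ GreedyPaths.copyCount≥ n m j 3+m≡ ⟩
      2 ^ (2 + m) * (copyCount (cycle p) (bipartite n) * (p * 2)) ≡⟨ arith₁ (2 ^ (2 + m)) p _ ⟩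
      2 ^ p * p * copyCount (cycle p) (bipartite n) ≡⟨ cong (λ t → t * p * copyCount (cycle p) (bipartite n)) 2^p≡ ⟩
      4 ^ suc j * p * copyCount (cycle p) (bipartite n)
        ≤⟨ *-monoʳ-≤ (4 ^ suc j * p) (copyCount≤extremal (cycle p) (cycle q) (bipartite n) (bipartite-free n k)) ⟩
      scaled n                                 ∎

-- ∣ f n - g n ∣ ≤ D * g n / n, with the denominator cleared.
Close : ℕ → (ℕ → ℕ) → (ℕ → ℕ) → Set
Close D f g = ∀ n → 1 ≤ n → n * f n ≤ (n + D) * g n × n * g n ≤ n * f n + D * g n

extremal-close : ∀ k l → 1 ≤ k → 2 ≤ l → ∃[ D ]
  Close D (λ n → 4 ^ l * (2 * l) * extremal n (cycle (2 * l)) (cycle (2 * k + 1))) (λ n → n ^ (2 * l))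
extremal-close (suc k) l@(suc j@(suc i)) (s≤s z≤n) (s≤s (s≤s z≤n)) =
  go (2 * l) (2 * suc k + 1) (arith₁ i) (trans (+-comm (2 * suc k) 1) (cong suc (*-comm 2 (suc k))))
  where
  arith₁ : ∀ i → 2 * (2 + i) ≡ 3 + suc (i * 2)
  arith₁ = solve-∀
  -- Both cycle lengths occur in types; as variables they can be replaced by the shapes that
  -- `Bounds` expects.
  go : ∀ p q → p ≡ 3 + suc (i * 2) → q ≡ suc (suc k * 2) → ∃[ D ]
       Close D (λ n → 4 ^ l * p * extremal n (cycle p) (cycle q)) (λ n → n ^ p)
  go p q refl refl = D₁ + D₂ , λ n 1≤n →
      ≤-trans (proj₂ upper n 1≤n) (*-monoˡ-≤ (n ^ p) (+-monoʳ-≤ n (m≤m+n D₁ D₂)))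
    , ≤-trans (proj₂ lower n) (+-monoʳ-≤ (n * scaled n) (*-monoˡ-≤ (n ^ p) (m≤n+m D₂ D₁)))
    where
    open Bounds k (suc (i * 2)) j refl
    D₁ = proj₁ upper
    D₂ = proj₁ lower

-- From integer bounds to the rational asymptotics

open import Data.Integer.Base as ℤ using (+_)
import Data.Integer.Properties as ℤ
open import Data.Rational.Base using (ℚ; _/_) renaming (_*_ to _*ℚ_)
import Data.Rational.Base as ℚ
import Data.Rational.Properties as ℚ
import Data.Rational.Unnormalised.Base as ℚᵘ
import Data.Rational.Unnormalised.Properties as ℚᵘ
open import Data.Rational.Solver using (module +-*-Solver)

-- A fraction `z / suc d` is `fromℚᵘ` of an unnormalised one by definition, so identities and
-- inequalities can be checked by cross-multiplication, without gcds.
fromℚᵘ-homo-* : ∀ p q → ℚ.fromℚᵘ p *ℚ ℚ.fromℚᵘ q ≡ ℚ.fromℚᵘ (p ℚᵘ.* q)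
fromℚᵘ-homo-* p q = ℚ.toℚᵘ-injective (ℚᵘ.≃-trans (ℚ.toℚᵘ-homo-* (ℚ.fromℚᵘ p) (ℚ.fromℚᵘ q))
  (ℚᵘ.≃-trans (ℚᵘ.*-cong (ℚ.toℚᵘ-fromℚᵘ p) (ℚ.toℚᵘ-fromℚᵘ q)) (ℚᵘ.≃-sym (ℚ.toℚᵘ-fromℚᵘ (p ℚᵘ.* q)))))

fromℚᵘ-homo-+ : ∀ p q → ℚ.fromℚᵘ p ℚ.+ ℚ.fromℚᵘ q ≡ ℚ.fromℚᵘ (p ℚᵘ.+ q)
fromℚᵘ-homo-+ p q = ℚ.toℚᵘ-injective (ℚᵘ.≃-trans (ℚ.toℚᵘ-homo-+ (ℚ.fromℚᵘ p) (ℚ.fromℚᵘ q))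
  (ℚᵘ.≃-trans (ℚᵘ.+-cong (ℚ.toℚᵘ-fromℚᵘ p) (ℚ.toℚᵘ-fromℚᵘ q)) (ℚᵘ.≃-sym (ℚ.toℚᵘ-fromℚᵘ (p ℚᵘ.+ q)))))

fromℚᵘ-mono-≤ : ∀ {p q} → p ℚᵘ.≤ q → ℚ.fromℚᵘ p ℚ.≤ ℚ.fromℚᵘ q
fromℚᵘ-mono-≤ {p} {q} p≤q = ℚ.toℚᵘ-cancel-≤ (ℚᵘ.≤-respˡ-≃ (ℚᵘ.≃-sym (ℚ.toℚᵘ-fromℚᵘ p))
  (ℚᵘ.≤-respʳ-≃ (ℚᵘ.≃-sym (ℚ.toℚᵘ-fromℚᵘ q)) p≤q))

fromℚᵘ-mono-< : ∀ {p q} → p ℚᵘ.< q → ℚ.fromℚᵘ p ℚ.< ℚ.fromℚᵘ q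
fromℚᵘ-mono-< {p} {q} p<q = ℚ.toℚᵘ-cancel-< (ℚᵘ.<-respˡ-≃ (ℚᵘ.≃-sym (ℚ.toℚᵘ-fromℚᵘ p))
  (ℚᵘ.<-respʳ-≃ (ℚᵘ.≃-sym (ℚ.toℚᵘ-fromℚᵘ q)) p<q))

ι : ℕ → ℚ
ι n = + n / 1

ι-* : ∀ a b → ι (a * b) ≡ ι a *ℚ ι b
ι-* a b = sym (trans (fromℚᵘ-homo-* (ℚᵘ.mkℚᵘ (+ a) 0) (ℚᵘ.mkℚᵘ (+ b) 0))
  (cong ι′ (sym (ℤ.pos-* a b))))
  where
  ι′ : ℤ.ℤ → ℚ
  ι′ z = ℚ.fromℚᵘ (ℚᵘ.mkℚᵘ z 0)

ι-+ : ∀ a b → ι (a + b) ≡ ι a ℚ.+ ι b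
ι-+ a b = sym (trans (fromℚᵘ-homo-+ (ℚᵘ.mkℚᵘ (+ a) 0) (ℚᵘ.mkℚᵘ (+ b) 0))
  (cong (λ z → ℚ.fromℚᵘ (ℚᵘ.mkℚᵘ z 0))
    (trans (cong₂ ℤ._+_ (ℤ.*-identityʳ (+ a)) (ℤ.*-identityʳ (+ b))) (sym (ℤ.pos-+ a b)))))

ι-^ : ∀ a l → ι (a ^ l) ≡ ι a ^ℚ l
ι-^ a zero    = refl
ι-^ a (suc l) = trans (ι-* a (a ^ l)) (cong (ι a *ℚ_) (ι-^ a l))

ι-mono-≤ : ∀ {a b} → a ≤ b → ι a ℚ.≤ ι b
ι-mono-≤ {a} {b} a≤b = fromℚᵘ-mono-≤ {ℚᵘ.mkℚᵘ (+ a) 0} {ℚᵘ.mkℚᵘ (+ b) 0} (ℚᵘ.*≤* (ℤ.*-monoʳ-≤-nonNeg (+ 1) (ℤ.+≤+ a≤b)))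

ι-mono-< : ∀ {a b} → a < b → ι a ℚ.< ι b
ι-mono-< {a} {b} a<b = fromℚᵘ-mono-< {ℚᵘ.mkℚᵘ (+ a) 0} {ℚᵘ.mkℚᵘ (+ b) 0} (ℚᵘ.*<* (ℤ.*-monoʳ-<-pos (+ 1) (ℤ.+<+ a<b)))

0≤ι : ∀ a → ℚ.0ℚ ℚ.≤ ι a
0≤ι a = ι-mono-≤ {0} {a} z≤n

0≤1/ : ∀ d .{{_ : NonZero d}} → ℚ.0ℚ ℚ.≤ + 1 / d
0≤1/ (suc d) = fromℚᵘ-mono-≤ {ℚᵘ.0ℚᵘ} {ℚᵘ.mkℚᵘ (+ 1) d} (ℚᵘ.nonNegative⁻¹ (ℚᵘ.mkℚᵘ (+ 1) d))

/-* : ∀ a d .{{_ : NonZero d}} → (+ a / d) *ℚ ι d ≡ ι a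
/-* a (suc d) = trans (fromℚᵘ-homo-* (ℚᵘ.mkℚᵘ (+ a) d) (ℚᵘ.mkℚᵘ (+ suc d) 0))
  (ℚ.fromℚᵘ-cong {ℚᵘ.mkℚᵘ (+ a) d ℚᵘ.* ℚᵘ.mkℚᵘ (+ suc d) 0} {ℚᵘ.mkℚᵘ (+ a) 0} (ℚᵘ.*≡* (trans (ℤ.*-identityʳ _)
    (cong (λ t → + a ℤ.* + t) (sym (*-identityʳ (suc d)))))))

^ℚ-distrib-* : ∀ l p q → (p *ℚ q) ^ℚ l ≡ p ^ℚ l *ℚ q ^ℚ l
^ℚ-distrib-* zero    p q = refl
^ℚ-distrib-* (suc l) p q = trans (cong (p *ℚ q *ℚ_) (^ℚ-distrib-* l p q))
  (solve 4 (λ a b c d → (a :* b) :* (c :* d) := (a :* c) :* (b :* d)) refl p q (p ^ℚ l) (q ^ℚ l))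
  where open +-*-Solver

-- The denominator of `ε` serves as M: the product is the numerator, a positive integer.
archimedean : ∀ ε → ℚ.0ℚ ℚ.< ε → ∃[ M ] ℚ.1ℚ ℚ.≤ ι M *ℚ ε
archimedean ε@(ℚ.mkℚ (+ suc a) d _) _ = suc d , subst (ℚ.1ℚ ℚ.≤_) (sym eq) (ι-mono-≤ {1} {suc a} (s≤s z≤n))
  where
  eq : ι (suc d) *ℚ ε ≡ ι (suc a)
  eq = trans (ℚ.*-comm (ι (suc d)) ε) (trans (cong (_*ℚ ι (suc d)) (sym (ℚ.fromℚᵘ-toℚᵘ ε))) (/-* (suc a) (suc d)))
archimedean (ℚ.mkℚ (+ 0) _ _)          (ℚ.*<* (ℤ.+<+ ()))
archimedean (ℚ.mkℚ ℤ.-[1+ _ ] _ _) (ℚ.*<* ())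

∣p∣≤ : ∀ {p q} → p ℚ.≤ q → ℚ.- p ℚ.≤ q → ℚ.∣ p ∣ ℚ.≤ q
∣p∣≤ {p} p≤q -p≤q with ℚ.∣p∣≡p∨∣p∣≡-p p
... | inj₁ eq = subst (ℚ._≤ _) (sym eq) p≤q
... | inj₂ eq = subst (ℚ._≤ _) (sym eq) -p≤q

-- Both hypotheses are divided by `P`. The factor `ι n` stays inside the absolute value, so the
-- relative error itself is at most D/n.
∣Y/P-1∣≤ : ∀ n D Y P .{{_ : NonZero P}} → n * Y ≤ (n + D) * P → n * P ≤ n * Y + D * P →
           ℚ.∣ ι n *ℚ (ι Y *ℚ (+ 1 / P) ℚ.- ℚ.1ℚ) ∣ ℚ.≤ ι D
∣Y/P-1∣≤ n D Y P nY≤ nP≤ = ∣p∣≤ above below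
  where
  open ℚ.≤-Reasoning
  open +-*-Solver
  r s : ℚ
  r = + 1 / P
  s = ι Y *ℚ r
  instance
    0≤r : ℚ.NonNegative r
    0≤r = ℚ.nonNegative (0≤1/ P)
  cancel : ∀ x → x *ℚ ι P *ℚ r ≡ x
  cancel x = trans (ℚ.*-assoc x (ι P) r)
    (trans (cong (x *ℚ_) (trans (ℚ.*-comm (ι P) r) (/-* 1 P))) (ℚ.*-identityʳ x))
  ns≤ : ι n *ℚ s ℚ.≤ ι n ℚ.+ ι D
  ns≤ = begin
    ι n *ℚ s                  ≡⟨ ℚ.*-assoc (ι n) (ι Y) r ⟨
    ι n *ℚ ι Y *ℚ r           ≡⟨ cong (_*ℚ r) (ι-* n Y) ⟨
    ι (n * Y) *ℚ r            ≤⟨ ℚ.*-monoʳ-≤-nonNeg r (ι-mono-≤ nY≤) ⟩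
    ι ((n + D) * P) *ℚ r      ≡⟨ cong (_*ℚ r) (ι-* (n + D) P) ⟩
    ι (n + D) *ℚ ι P *ℚ r     ≡⟨ cancel (ι (n + D)) ⟩
    ι (n + D)                 ≡⟨ ι-+ n D ⟩
    ι n ℚ.+ ι D               ∎
  n≤ : ι n ℚ.≤ ι n *ℚ s ℚ.+ ι D
  n≤ = begin
    ι n                       ≡⟨ cancel (ι n) ⟨
    ι n *ℚ ι P *ℚ r           ≡⟨ cong (_*ℚ r) (ι-* n P) ⟨
    ι (n * P) *ℚ r            ≤⟨ ℚ.*-monoʳ-≤-nonNeg r (ι-mono-≤ nP≤) ⟩
    ι (n * Y + D * P) *ℚ r    ≡⟨ cong (_*ℚ r) (trans (ι-+ (n * Y) (D * P)) (cong₂ ℚ._+_ (ι-* n Y) (ι-* D P))) ⟩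
    (ι n *ℚ ι Y ℚ.+ ι D *ℚ ι P) *ℚ r ≡⟨ ℚ.*-distribʳ-+ r (ι n *ℚ ι Y) (ι D *ℚ ι P) ⟩
    ι n *ℚ ι Y *ℚ r ℚ.+ ι D *ℚ ι P *ℚ r ≡⟨ cong₂ ℚ._+_ (ℚ.*-assoc (ι n) (ι Y) r) (cancel (ι D)) ⟩
    ι n *ℚ s ℚ.+ ι D          ∎
  above : ι n *ℚ (s ℚ.- ℚ.1ℚ) ℚ.≤ ι D
  above = begin
    ι n *ℚ (s ℚ.- ℚ.1ℚ)       ≡⟨ solve 2 (λ x y → x :* (y :- con ℚ.1ℚ) := x :* y :- x) refl (ι n) s ⟩
    ι n *ℚ s ℚ.- ι n          ≤⟨ ℚ.+-monoˡ-≤ (ℚ.- ι n) ns≤ ⟩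
    ι n ℚ.+ ι D ℚ.- ι n       ≡⟨ solve 2 (λ x y → x :+ y :- x := y) refl (ι n) (ι D) ⟩
    ι D                       ∎
  below : ℚ.- (ι n *ℚ (s ℚ.- ℚ.1ℚ)) ℚ.≤ ι D
  below = begin
    ℚ.- (ι n *ℚ (s ℚ.- ℚ.1ℚ)) ≡⟨ solve 2 (λ x y → :- (x :* (y :- con ℚ.1ℚ)) := x :- x :* y) refl (ι n) s ⟩
    ι n ℚ.- ι n *ℚ s          ≤⟨ ℚ.+-monoˡ-≤ (ℚ.- (ι n *ℚ s)) n≤ ⟩
    ι n *ℚ s ℚ.+ ι D ℚ.- ι n *ℚ s ≡⟨ solve 2 (λ x y → x :+ y :- x := y) refl (ι n *ℚ s) (ι D) ⟩
    ι D                       ∎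

scale : ∀ l n .{{_ : NonZero (2 * l)}} →
        (+ 1 / (2 * l)) *ℚ ((+ (n ^ 2) / 4) ^ℚ l) *ℚ ι (4 ^ l * (2 * l)) ≡ ι (n ^ (2 * l))
scale l n = begin
  u *ℚ v ^ℚ l *ℚ ι (4 ^ l * (2 * l))       ≡⟨ cong (λ t → u *ℚ v ^ℚ l *ℚ t) (trans (ι-* (4 ^ l) (2 * l)) (cong (_*ℚ ι (2 * l)) (ι-^ 4 l))) ⟩
  u *ℚ v ^ℚ l *ℚ (ι 4 ^ℚ l *ℚ ι (2 * l))   ≡⟨ solve 4 (λ a b c d → a :* b :* (c :* d) := a :* d :* (b :* c)) refl u (v ^ℚ l) (ι 4 ^ℚ l) (ι (2 * l)) ⟩
  u *ℚ ι (2 * l) *ℚ (v ^ℚ l *ℚ ι 4 ^ℚ l)   ≡⟨ cong₂ _*ℚ_ (/-* 1 (2 * l)) (sym (^ℚ-distrib-* l v (ι 4))) ⟩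
  ℚ.1ℚ *ℚ (v *ℚ ι 4) ^ℚ l                  ≡⟨ ℚ.*-identityˡ _ ⟩
  (v *ℚ ι 4) ^ℚ l                          ≡⟨ cong (_^ℚ l) (/-* (n ^ 2) 4) ⟩
  ι (n ^ 2) ^ℚ l                           ≡⟨ ι-^ (n ^ 2) l ⟨
  ι ((n ^ 2) ^ l)                          ≡⟨ cong ι (^-*-assoc n 2 l) ⟩
  ι (n ^ (2 * l))                          ∎
  where
  open ≡-Reasoning
  open +-*-Solver
  u v : ℚ
  u = + 1 / (2 * l)
  v = + (n ^ 2) / 4

module Asymptotics (l : ℕ) .{{_ : NonZero (2 * l)}} (D : ℕ) (X : ℕ → ℕ)
                   (close : Close D (λ n → 4 ^ l * (2 * l) * X n) (λ n → n ^ (2 * l))) where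

  δ : ℕ → ℚ
  -- A placeholder: at n = 0 the main term vanishes and cannot be divided by. The asymptotic
  -- identity is claimed from n = 1 on.
  δ zero      = ℚ.0ℚ
  δ n@(suc _) = ι (4 ^ l * (2 * l) * X n) *ℚ (_/_ (+ 1) (n ^ (2 * l)) {{m^n≢0 n (2 * l)}}) ℚ.- ℚ.1ℚ

  δ-null : Null δ
  δ-null ε 0<ε with archimedean ε 0<ε
  -- For n > DM the bound n·∣δ n∣ ≤ D ≤ DMε < nε follows, and n cancels.
  ... | M , 1≤Mε = suc (D * M) , small
    where
    open ℚ.≤-Reasoning
    small : ∀ n → suc (D * M) ≤ n → ℚ.∣ δ n ∣ ℚ.< ε
    small n@(suc _) DM<n = ℚ.*-cancelˡ-<-nonNeg (ι n) (begin-strict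
      ι n *ℚ ℚ.∣ δ n ∣            ≡⟨ cong (_*ℚ ℚ.∣ δ n ∣) (ℚ.0≤p⇒∣p∣≡p (0≤ι n)) ⟨
      ℚ.∣ ι n ∣ *ℚ ℚ.∣ δ n ∣      ≡⟨ ℚ.∣p*q∣≡∣p∣*∣q∣ (ι n) (δ n) ⟨
      ℚ.∣ ι n *ℚ δ n ∣            ≤⟨ ∣Y/P-1∣≤ n D _ (n ^ (2 * l)) {{m^n≢0 n (2 * l)}} (proj₁ (close n (s≤s z≤n))) (proj₂ (close n (s≤s z≤n))) ⟩
      ι D                         ≡⟨ ℚ.*-identityʳ (ι D) ⟨
      ι D *ℚ ℚ.1ℚ                 ≤⟨ ℚ.*-monoˡ-≤-nonNeg (ι D) {{ℚ.nonNegative (0≤ι D)}} 1≤Mε ⟩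
      ι D *ℚ (ι M *ℚ ε)           ≡⟨ ℚ.*-assoc (ι D) (ι M) ε ⟨
      ι D *ℚ ι M *ℚ ε             ≡⟨ cong (_*ℚ ε) (ι-* D M) ⟨
      ι (D * M) *ℚ ε              <⟨ ℚ.*-monoˡ-<-pos ε {{ℚ.positive 0<ε}} (ι-mono-< DM<n) ⟩
      ι n *ℚ ε                    ∎)
      where
      instance
        0≤n : ℚ.NonNegative (ι n)
        0≤n = ℚ.nonNegative (0≤ι n)

  X≡ : ∀ n → 1 ≤ n → ι (X n) ≡ (ℚ.1ℚ ℚ.+ δ n) *ℚ ((+ 1 / (2 * l)) *ℚ ((+ (n ^ 2) / 4) ^ℚ l))
  X≡ n@(suc _) _ = sym (begin
    (ℚ.1ℚ ℚ.+ (ι (K * X n) *ℚ r ℚ.- ℚ.1ℚ)) *ℚ g ≡⟨ cong (λ t → (ℚ.1ℚ ℚ.+ (t *ℚ r ℚ.- ℚ.1ℚ)) *ℚ g) (ι-* K (X n)) ⟩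
    (ℚ.1ℚ ℚ.+ (ι K *ℚ ι (X n) *ℚ r ℚ.- ℚ.1ℚ)) *ℚ g
      ≡⟨ solve 4 (λ c x y z → (con ℚ.1ℚ :+ (c :* x :* y :- con ℚ.1ℚ)) :* z := x :* (y :* (z :* c))) refl (ι K) (ι (X n)) r g ⟩
    ι (X n) *ℚ (r *ℚ (g *ℚ ι K))            ≡⟨ cong (λ t → ι (X n) *ℚ (r *ℚ t)) (scale l n) ⟩
    ι (X n) *ℚ (r *ℚ ι (n ^ (2 * l)))       ≡⟨ cong (ι (X n) *ℚ_) (/-* 1 (n ^ (2 * l)) {{m^n≢0 n (2 * l)}}) ⟩
    ι (X n) *ℚ ℚ.1ℚ                         ≡⟨ ℚ.*-identityʳ (ι (X n)) ⟩
    ι (X n)                                 ∎)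
    where
    open ≡-Reasoning
    open +-*-Solver
    K = 4 ^ l * (2 * l)
    r g : ℚ
    r = _/_ (+ 1) (n ^ (2 * l)) {{m^n≢0 n (2 * l)}}
    g = (+ 1 / (2 * l)) *ℚ ((+ (n ^ 2) / 4) ^ℚ l)

  asymptotic : (f : ℕ → ℕ) → (∀ n → X n ≡ f n) →
               (λ n → + f n / 1) ~[1+o1] (λ n → (+ 1 / (2 * l)) *ℚ ((+ (n ^ 2) / 4) ^ℚ l))
  asymptotic f X≡f = δ , δ-null , 1 , λ n 1≤n → trans (cong ι (sym (X≡f n))) (X≡ n 1≤n)

theorem20 : ∀ (k l : ℕ) → 1 ≤ k → (2≤l : 2 ≤ l) →
    (λ n → + ex n (cycle (2 * l)) (cycle (2 * k + 1)) / 1)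
    ~[1+o1]
    (λ n → _/_ (+ 1) (2 * l) {{2*-nonZero 2≤l}} *ℚ ((+ (n ^ 2) / 4) ^ℚ l))
theorem20 k l 1≤k 2≤l = asymptotic (λ n → ex n (cycle (2 * l)) (cycle (2 * k + 1)))
                                   (λ n → extremal≡ n (cycle (2 * l)) (cycle (2 * k + 1)))
  where
  open Asymptotics l {{2*-nonZero 2≤l}} (proj₁ (extremal-close k l 1≤k 2≤l))
    (λ n → extremal n (cycle (2 * l)) (cycle (2 * k + 1))) (proj₂ (extremal-close k l 1≤k 2≤l))
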